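{- Let $\ell$ be a positive integer and $0<m\le n$ integers. The number $D[\ell]_{n,m}$ is $0$ unless $m\equiv n \pmod \ell$, in which case $$D[\ell]_{n,m}=\frac{1}{n+1}\binom{m-1+(n-m)/\ell}{m-1}\binom{n+m}{m}.$$
   Context: A dissection of a convex polygon with labelled vertices is a set of pairwise non-crossing diagonals, partitioning the polygon into sub-polygons (cells). A dissection is $\ell$-periodic if each cell has $3+\ell d$ vertices for some integer $d\ge0$. $D[\ell]_{n,m}$ is the number of $\ell$-periodic dissections of a fixed convex $(n+2)$-gon with exactly $m$ cells. -}

module Defs where

open import Data.Bool using (Bool; true; false; _∧_; _∨_; not; if_then_else_)
open import Data.Nat using (ℕ; zero; suc; _+_; _∸_; _≡ᵇ_; _<ᵇ_; NonZero)
open import Data.Nat.Divisibility using (_∣?_)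
open import Data.List using (List; []; _∷_; map; concatMap; length; filterᵇ; upTo; _++_)
open import Data.Bool.ListAction using (all; any)
open import Data.Product using (_×_; _,_)
open import Relation.Nullary.Decidable using (⌊_⌋)

-- Vertices of the convex N-gon are labelled 0,1,…,N-1 in cyclic order.
-- An (unordered) pair of vertices is represented as (a , b) with a < b.

Edge : Set
Edge = ℕ × ℕ

eqEdge : Edge → Edge → Bool
eqEdge (a , b) (c , d) = (a ≡ᵇ c) ∧ (b ≡ᵇ d)

memEdge : Edge → List Edge → Bool
memEdge e = any (eqEdge e)

sublists : {A : Set} → List A → List (List A)
sublists [] = [] ∷ []
sublists (x ∷ xs) = let r = sublists xs in map (x ∷_) r ++ r

isSide : ℕ → Edge → Bool
isSide N (a , b) = (suc a ≡ᵇ b) ∨ ((a ≡ᵇ 0) ∧ (suc b ≡ᵇ N))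

diagonals : ℕ → List Edge
diagonals N = filterᵇ (λ e → not (isSide N e))
  (concatMap (λ b → map (λ a → (a , b)) (upTo b)) (upTo N))

crosses : Edge → Edge → Bool
crosses (a , b) (c , d) =
  ((a <ᵇ c) ∧ (c <ᵇ b) ∧ (b <ᵇ d)) ∨ ((c <ᵇ a) ∧ (a <ᵇ d) ∧ (d <ᵇ b))

pairwiseNonCrossing : List Edge → Bool
pairwiseNonCrossing D = all (λ e → all (λ f → not (crosses e f)) D) D

orderedPairs : List ℕ → List Edge
orderedPairs [] = []
orderedPairs (x ∷ xs) = map (x ,_) xs ++ orderedPairs xs

lastOf : ℕ → List ℕ → ℕ
lastOf x [] = x
lastOf x (y ∷ ys) = lastOf y ys

adjacentPairs : List ℕ → List Edge
adjacentPairs [] = []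
adjacentPairs (x ∷ []) = []
adjacentPairs (x ∷ y ∷ ys) = (x , y) ∷ adjacentPairs (y ∷ ys)

cyclicPairs : List ℕ → List Edge
cyclicPairs [] = []
cyclicPairs (x ∷ xs) = adjacentPairs (x ∷ xs) ++ ((x , lastOf x xs) ∷ [])

-- An increasing list S of vertices (|S| ≥ 3) spans a cell (a sub-polygon of the
-- dissection by the diagonal set D) iff every side of the polygon conv(S) is a side
-- of the N-gon or a diagonal in D, and no diagonal of D joins two non-consecutive
-- vertices of S (i.e. no diagonal of D cuts through the interior of conv(S)).
isCell : ℕ → List Edge → List ℕ → Bool
isCell N D S =
  (3 <ᵇ suc (length S)) ∧
  all (λ e → if memEdge e (cyclicPairs S)
             then (isSide N e ∨ memEdge e D)
             else not (memEdge e D))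
      (orderedPairs S)

cells : ℕ → List Edge → List (List ℕ)
cells N D = filterᵇ (isCell N D) (sublists (upTo N))

isPeriodic : ℕ → ℕ → List Edge → Bool
isPeriodic ℓ N D = all (λ S → (3 <ᵇ suc (length S)) ∧ ⌊ ℓ ∣? (length S ∸ 3) ⌋) (cells N D)

D[_]_,_ : ℕ → ℕ → ℕ → ℕ
D[ ℓ ] n , m = length (filterᵇ
  (λ D → pairwiseNonCrossing D ∧ (length (cells (n + 2) D) ≡ᵇ m) ∧ isPeriodic ℓ (n + 2) D)
  (sublists (diagonals (n + 2))))

{-# OPTIONS --safe #-}

-- Cutting along diagonals identifies the dissections of a polygon rooted at the side (0 , M) with
-- plane trees: cells are internal nodes and the other sides are leaves. Let the left end a descend
-- from M to 0 and let b ascend for each a. Deciding then whether (a , b) belongs to the dissection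
-- only involves the chain of vertices of {a , …, M} not yet cut off: (a , b) crosses no earlier
-- diagonal iff b is on the chain, and it then closes exactly one new cell, the part of the chain
-- from a to b. Hence the number F(k, t, m) of states with t leaves, m cells and a chain of k edges
-- satisfies F(k+1, t+1, m+1) = F(k, t, m+1) + Σ_d F(k + 2 + dℓ, t+1, m), according to whether the
-- first edge of the chain is a side or a diagonal. This recursion has the solution
-- F(k, t, m) = k/p · C(p, m) · C(m−1+q, m−1) with t = k + m + qℓ and p = t + m, and F = 0 for other t.
-- The theorem is the case k = 1, t = n + 1.

module Submission where

open import Defs
open import Data.Bool using (Bool; true; false; _∧_; _∨_; not; T; if_then_else_)
open import Data.Bool.ListAction using (all)
open import Data.Bool.Properties using (T-∧; T-∨)
open import Data.Empty using (⊥; ⊥-elim)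
open import Data.List using (List; []; _∷_; _++_; length; map; mapMaybe; filterᵇ; upTo; concatMap)
open import Data.List.Membership.Propositional using (_∈_; _∉_; find; lose)
open import Data.List.Membership.Propositional.Properties using (∈-++⁺ˡ; ∈-++⁺ʳ; ∈-++⁻; ∈-∃++; ∈-map⁺; ∈-map⁻; ∈-filter⁺; ∈-filter⁻; ∈-upTo⁺; ∈-upTo⁻; ∈-concatMap⁺; ∈-concatMap⁻)
open import Data.List.Membership.Propositional.Properties.WithK using (unique∧set⇒bag)
open import Data.List.Properties using (length-++; filter-++; map-++; map-∘; ∷-injectiveʳ)
open import Data.List.Relation.Binary.BagAndSetEquality using (∼bag⇒↭)
open import Data.List.Relation.Binary.Permutation.Propositional as ↭ using (_↭_; ↭-sym)
open import Data.List.Relation.Binary.Permutation.Propositional.Properties using (∈-resp-↭; All-resp-↭; ↭-length)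
open import Data.List.Relation.Unary.All as All using (All; []; _∷_)
open import Data.List.Relation.Unary.All.Properties using (¬Any⇒All¬; all⁺; all⁻; ++⁺; map⁺)
open import Data.List.Relation.Unary.AllPairs as AllPairs using (AllPairs; []; _∷_)
import Data.List.Relation.Unary.AllPairs.Properties as AllPairs
open import Data.List.Relation.Unary.Any using (here; there)
open import Data.List.Relation.Unary.Any.Properties using (any⁺; any⁻)
open import Data.List.Relation.Unary.Unique.Propositional using (Unique)
import Data.List.Relation.Unary.Unique.Propositional.Properties as Unique
open import Data.Maybe using (Maybe; just; nothing; maybe′)
open import Data.Nat
open import Data.Nat.Combinatorics using (_C_; nC1≡n; nCn≡1; nCk≡nC[n∸k]; k>n⇒nCk≡0; nCk+nC[k+1]≡[n+1]C[k+1])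
open import Data.Nat.DivMod using (_/_; _%_; m≡m%n+[m/n]*n; [m+kn]%n≡m%n; m*n/n≡m; /-monoˡ-≤)
open import Data.Nat.Divisibility using (_∣?_; divides)
open import Data.Nat.ListAction using (sum)
open import Data.Nat.Properties
open import Data.List.Membership.DecPropositional _≟_ using (_∈?_)
open import Data.Nat.Tactic.RingSolver using (solve-∀)
open import Data.Product using (_×_; _,_; proj₁; proj₂; ∃; ∃₂)
open import Data.Sum using (_⊎_; inj₁; inj₂; [_,_]′; map₂)
open import Function using (_∘_; id; Equivalence; mk⇔)
open import Relation.Binary.PropositionalEquality
open import Relation.Nullary using (¬_; yes; no; contradiction)
open import Relation.Nullary.Decidable using (⌊_⌋; T?; toWitness; fromWitness)

-- The obstacle is that `cells` is global: it tests every vertex subset against the finished set of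
-- diagonals. To follow it edge by edge, the root side is counted among the edges, so that every
-- cell is owned by the edge joining its extreme vertices. In the chosen order no new edge lies
-- inside an earlier one; hence a new edge never cuts an old cell, and it creates only the cell that
-- it owns. The sum over d in the recursion has no fixed length. `H` names it, and a two-term
-- recursion replaces the summation; closed forms for `F` and `H` are then proved alternately, by
-- induction on m, with all denominators cleared. For fixed a the candidates b are decided one at a
-- time, whereas the recursion speaks of all of them at once. A forest whose first chain edge (a ,
-- b) is a diagonal arises from exactly one configuration, found by undoing the merge at b;
-- `isPending` charges that configuration when the threshold reaches this b.

private variable
  A B : Set

-- Binomial identities and the solution of the recursion

nC0≡1 : ∀ n → n C 0 ≡ 1
nC0≡1 zero = refl
nC0≡1 (suc n) = trans (cong (suc n C_) (sym (n∸n≡0 (suc n)))) (trans (sym (nCk≡nC[n∸k] (≤-refl {suc n}))) (nCn≡1 (suc n)))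

absorption : ∀ n k → suc k * (suc n C suc k) ≡ suc n * (n C k)
absorption zero zero = refl
absorption zero (suc k) = begin
  suc (suc k) * (1 C suc (suc k)) ≡⟨ cong (suc (suc k) *_) (k>n⇒nCk≡0 {1} {suc (suc k)} (s≤s (s≤s z≤n))) ⟩
  suc (suc k) * 0                 ≡⟨ *-zeroʳ (suc (suc k)) ⟩
  0                               ≡⟨ cong (1 *_) (k>n⇒nCk≡0 {0} {suc k} (s≤s z≤n)) ⟨
  1 * (0 C suc k)                 ∎
  where open ≡-Reasoning
absorption (suc n) zero = begin
  1 * (suc (suc n) C 1)           ≡⟨ cong (1 *_) (nC1≡n (suc (suc n))) ⟩
  1 * suc (suc n)                 ≡⟨ *-comm 1 (suc (suc n)) ⟩
  suc (suc n) * 1                 ≡⟨ cong (suc (suc n) *_) (nC0≡1 (suc n)) ⟨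
  suc (suc n) * (suc n C 0)       ∎
  where open ≡-Reasoning
absorption (suc n) (suc k) = begin
  suc (suc k) * (suc (suc n) C suc (suc k))
    ≡⟨ cong (suc (suc k) *_) (nCk+nC[k+1]≡[n+1]C[k+1] (suc n) (suc k)) ⟨
  suc (suc k) * (x + (suc n C suc (suc k)))
    ≡⟨ *-distribˡ-+ (suc (suc k)) x _ ⟩
  (x + suc k * x) + suc (suc k) * (suc n C suc (suc k))
    ≡⟨ cong₂ _+_ (cong (x +_) (absorption n k)) (absorption n (suc k)) ⟩
  (x + suc n * (n C k)) + suc n * (n C suc k)
    ≡⟨ +-assoc x _ _ ⟩
  x + (suc n * (n C k) + suc n * (n C suc k))
    ≡⟨ cong (x +_) (*-distribˡ-+ (suc n) (n C k) (n C suc k)) ⟨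
  x + suc n * (n C k + n C suc k)
    ≡⟨ cong (λ z → x + suc n * z) (nCk+nC[k+1]≡[n+1]C[k+1] n k) ⟩
  x + suc n * x ∎
  where
  open ≡-Reasoning
  x = suc n C suc k

-- (k + 1) C(n, k + 1) = (n − k) C(n, k), with the subtracted term moved to the left.
absorption-upper : ∀ n k → suc k * (n C suc k) + k * (n C k) ≡ n * (n C k)
absorption-upper n k = +-cancelˡ-≡ (n C k) _ _ (begin
  (n C k) + (suc k * (n C suc k) + k * (n C k))  ≡⟨ lemma k (n C k) (n C suc k) ⟩
  suc k * (n C k + n C suc k)                    ≡⟨ cong (suc k *_) (nCk+nC[k+1]≡[n+1]C[k+1] n k) ⟩
  suc k * (suc n C suc k)                        ≡⟨ absorption n k ⟩
  suc n * (n C k)                                ∎)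
  where
  open ≡-Reasoning
  lemma : ∀ k x y → x + (suc k * y + k * x) ≡ suc k * (x + y)
  lemma = solve-∀

-- Counts the ways to write q as an ordered sum of m natural numbers, that is, to distribute q
-- portions of ℓ extra vertices among m cells. The case m = 0 is separate because truncated
-- subtraction would falsify C(m-1+q, m-1) there.
weakCompositions : ℕ → ℕ → ℕ
weakCompositions zero    zero    = 1
weakCompositions zero    (suc q) = 0
weakCompositions (suc m) q       = (m + q) C m

weakCompositions-0 : ∀ m → weakCompositions m 0 ≡ 1
weakCompositions-0 zero    = refl
weakCompositions-0 (suc m) = trans (cong (_C m) (+-identityʳ m)) (nCn≡1 m)

weakCompositions-suc : ∀ m q →
  weakCompositions (suc m) (suc q) ≡ weakCompositions m (suc q) + weakCompositions (suc m) q
weakCompositions-suc zero    q = trans (nC0≡1 (suc q)) (sym (nC0≡1 q))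
weakCompositions-suc (suc m) q = begin
  suc (m + suc q) C suc m                    ≡⟨ nCk+nC[k+1]≡[n+1]C[k+1] (m + suc q) m ⟨
  (m + suc q) C m + (m + suc q) C suc m      ≡⟨ cong (λ z → (m + suc q) C m + z C suc m) (+-suc m q) ⟩
  (m + suc q) C m + suc (m + q) C suc m      ∎
  where open ≡-Reasoning

-- A ratio of neighbouring binomial coefficients in row m + q. In `F⇒H` it absorbs the surplus ℓ m
-- that arises when k is replaced by k + ℓ.
weakCompositions-shift : ∀ m q →
  m * weakCompositions (suc m) q ≡ suc q * weakCompositions m (suc q)
weakCompositions-shift zero    q = sym (*-zeroʳ (suc q))
weakCompositions-shift (suc m) q = +-cancelʳ-≡ (m * (x C m)) _ _ (begin
  suc m * (suc (m + q) C suc m) + m * (x C m)  ≡⟨ cong (λ z → suc m * (z C suc m) + m * (x C m)) (+-suc m q) ⟨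
  suc m * (x C suc m) + m * (x C m)            ≡⟨ absorption-upper x m ⟩
  (m + suc q) * (x C m)                        ≡⟨ lemma m q (x C m) ⟩
  suc q * (x C m) + m * (x C m)                ∎)
  where
  open ≡-Reasoning
  x = m + suc q
  lemma : ∀ m q y → (m + suc q) * y ≡ suc q * y + m * y
  lemma = solve-∀

-- F a t k m stands for the number of plane forests with k trees, t leaves and m internal nodes, all
-- of arity 2 + d ℓ, and H a t k m sums F a t (2 + k + d ℓ) m over d ≥ 0. The label a of the
-- leftmost polygon vertex is carried along, although the numbers do not depend on it.
module ForestNumbers
  (ℓ : ℕ) (0<ℓ : 0 < ℓ)
  (F H : ℕ → ℕ → ℕ → ℕ → ℕ)
  (F-empty : ∀ a → F a 0 0 0 ≡ 1)
  (F-rootless : ∀ a t m → F a (suc t) 0 m ≡ 0)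
  (F-bare : ∀ a t k → F a (suc t) (suc k) 0 ≡ F (suc a) t k 0)
  (F-step : ∀ a t k m → F a (suc t) (suc k) (suc m) ≡ F (suc a) t k (suc m) + H a (suc t) k m)
  (H-step : ∀ a t k m → H a t k m ≡ F a t (2 + k) m + H a t (k + ℓ) m)
  (H-vanish : ∀ a t k m → t < 2 + k + m → H a t k m ≡ 0)
  where

  open ≡-Reasoning

  -- Rationally, F = k/p · C(p, m) · weakCompositions m q.
  ClosedF : ℕ → Set
  ClosedF m = ∀ k q a {t p} → t ≡ k + m + q * ℓ → p ≡ k + (m + m) + q * ℓ →
    p * F a t k m ≡ k * ((p C m) * weakCompositions m q)

  -- Rationally, H = (p + k m)/(p (m + 1)) · C(p, m) · weakCompositions (m + 1) q;
  -- this is the difference of two values of F by F-step.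
  ClosedH : ℕ → Set
  ClosedH m = ∀ q k a {t p} → t ≡ 2 + k + m + q * ℓ → p ≡ 2 + k + (m + m) + q * ℓ →
    suc m * (p * H a t k m) ≡ ((p C m) * weakCompositions (suc m) q) * (p + k * m)

  -- Without internal nodes every tree is a single leaf, so t = k is the only possibility;
  -- `F-bare-suc` treats the values t > k.
  F-bare-0 : ∀ k a → F a k k 0 ≡ 1
  F-bare-0 zero    a = F-empty a
  F-bare-0 (suc k) a = trans (F-bare a k k) (F-bare-0 k (suc a))

  F-bare-suc : ∀ k a r → F a (k + suc r) k 0 ≡ 0
  F-bare-suc zero    a r = F-rootless a r 0
  F-bare-suc (suc k) a r = trans (F-bare a (k + suc r) k) (F-bare-suc k (suc a) r)

  closedF-0 : ClosedF 0
  closedF-0 k zero a refl refl = begin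
    x * F a x k 0                   ≡⟨ cong (λ z → x * F a z k 0) eq ⟩
    x * F a k k 0                   ≡⟨ cong (x *_) (F-bare-0 k a) ⟩
    x * 1                           ≡⟨ cong (_* 1) eq ⟩
    k * 1                           ≡⟨ cong (λ z → k * (z * 1)) (nC0≡1 x) ⟨
    k * ((x C 0) * 1)               ∎
    where
    x = k + 0 + 0
    eq : x ≡ k
    eq = trans (+-identityʳ (k + 0)) (+-identityʳ k)
  closedF-0 k (suc q) a refl refl = begin
    x * F a x k 0                   ≡⟨ cong (λ z → x * F a z k 0) eq ⟩
    x * F a (k + suc r) k 0         ≡⟨ cong (x *_) (F-bare-suc k a r) ⟩
    x * 0                           ≡⟨ *-zeroʳ x ⟩
    0                               ≡⟨ *-zeroʳ k ⟨
    k * 0                           ≡⟨ cong (k *_) (*-zeroʳ (x C 0)) ⟨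
    k * ((x C 0) * 0)               ∎
    where
    x = k + 0 + suc q * ℓ
    r = pred (suc q * ℓ)
    eq : x ≡ k + suc r
    eq = cong₂ _+_ (+-identityʳ k)
           (sym (suc-pred (suc q * ℓ) {{>-nonZero (≤-trans 0<ℓ (m≤m+n ℓ (q * ℓ)))}}))

  -- Induction on q: `H-step` passes from (k , q + 1) to (k + ℓ , q) and keeps t and p. At q = 0 the
  -- rest of the sum vanishes, because t = 2 + k + m leaves too few leaves for k + ℓ.
  F⇒H : ∀ {m} → ClosedF m → ClosedH m
  F⇒H {m} f zero k a {t} {p} t≡ p≡ = begin
    suc m * (p * H a t k m)
      ≡⟨ cong (λ z → suc m * (p * z)) (trans (H-step a t k m) (trans (cong (F a t (2 + k) m +_) vanish) (+-identityʳ _))) ⟩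
    suc m * (p * F a t (2 + k) m)
      ≡⟨ cong (suc m *_) (f (2 + k) 0 a t≡ p≡) ⟩
    suc m * ((2 + k) * ((p C m) * weakCompositions m 0))
      ≡⟨ cong (λ z → suc m * ((2 + k) * ((p C m) * z))) (trans (weakCompositions-0 m) (sym (weakCompositions-0 (suc m)))) ⟩
    suc m * ((2 + k) * ((p C m) * weakCompositions (suc m) 0))
      ≡⟨ lemma m k ((p C m) * weakCompositions (suc m) 0) ⟩
    (p C m) * weakCompositions (suc m) 0 * ((2 + k + (m + m) + 0) + k * m)
      ≡⟨ cong (λ z → (p C m) * weakCompositions (suc m) 0 * (z + k * m)) p≡ ⟨
    (p C m) * weakCompositions (suc m) 0 * (p + k * m) ∎
    where
    vanish : H a t (k + ℓ) m ≡ 0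
    vanish = H-vanish a t (k + ℓ) m (subst (_< 2 + (k + ℓ) + m) (sym (trans t≡ (+-identityʳ _)))
      (+-monoˡ-< m (+-monoʳ-< 2 (m<m+n k 0<ℓ))))
    lemma : ∀ m k x → suc m * ((2 + k) * x) ≡ x * ((2 + k + (m + m) + 0) + k * m)
    lemma = solve-∀
  F⇒H {m} f (suc q) k a {t} {p} t≡ p≡ = begin
    suc m * (p * H a t k m)
      ≡⟨ cong (λ z → suc m * (p * z)) (H-step a t k m) ⟩
    suc m * (p * (F a t (2 + k) m + H a t (k + ℓ) m))
      ≡⟨ lemma₁ m p _ _ ⟩
    suc m * (p * F a t (2 + k) m) + suc m * (p * H a t (k + ℓ) m)
      ≡⟨ cong₂ _+_ (cong (suc m *_) (f (2 + k) (suc q) a t≡ p≡))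
           (F⇒H f q (k + ℓ) a (trans t≡ (reassoc₁ k m ℓ q)) (trans p≡ (reassoc₂ k m ℓ q))) ⟩
    suc m * ((2 + k) * (c * w)) + (c * v) * (p + (k + ℓ) * m)
      ≡⟨ lemma₂ m k c w v p ℓ ⟩
    c * (suc m * (2 + k) * w + v * (p + k * m) + ℓ * (m * v))
      ≡⟨ cong (λ z → c * (suc m * (2 + k) * w + v * (p + k * m) + ℓ * z)) (weakCompositions-shift m q) ⟩
    c * (suc m * (2 + k) * w + v * (p + k * m) + ℓ * (suc q * w))
      ≡⟨ lemma₃ m k c w v p ℓ q ⟩
    c * (w * ((2 + k + (m + m) + suc q * ℓ) + k * m) + v * (p + k * m))
      ≡⟨ cong (λ z → c * (w * (z + k * m) + v * (p + k * m))) p≡ ⟨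
    c * (w * (p + k * m) + v * (p + k * m))
      ≡⟨ lemma₄ c w v (p + k * m) ⟩
    c * (w + v) * (p + k * m)
      ≡⟨ cong (λ z → c * z * (p + k * m)) (weakCompositions-suc m q) ⟨
    c * weakCompositions (suc m) (suc q) * (p + k * m) ∎
    where
    c = p C m
    w = weakCompositions m (suc q)
    v = weakCompositions (suc m) q
    reassoc₁ : ∀ k m ℓ q → 2 + k + m + suc q * ℓ ≡ 2 + (k + ℓ) + m + q * ℓ
    reassoc₁ = solve-∀
    reassoc₂ : ∀ k m ℓ q → 2 + k + (m + m) + suc q * ℓ ≡ 2 + (k + ℓ) + (m + m) + q * ℓ
    reassoc₂ = solve-∀
    lemma₁ : ∀ m p x y → suc m * (p * (x + y)) ≡ suc m * (p * x) + suc m * (p * y)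
    lemma₁ = solve-∀
    lemma₂ : ∀ m k c w v p ℓ → suc m * ((2 + k) * (c * w)) + (c * v) * (p + (k + ℓ) * m)
      ≡ c * (suc m * (2 + k) * w + v * (p + k * m) + ℓ * (m * v))
    lemma₂ = solve-∀
    lemma₃ : ∀ m k c w v p ℓ q → c * (suc m * (2 + k) * w + v * (p + k * m) + ℓ * (suc q * w))
      ≡ c * (w * ((2 + k + (m + m) + suc q * ℓ) + k * m) + v * (p + k * m))
    lemma₃ = solve-∀
    lemma₄ : ∀ c w v x → c * (w * x + v * x) ≡ c * (w + v) * x
    lemma₄ = solve-∀

  -- Induction on k. Both summands of `F-step` have the same value r of leaves plus nodes, one less
  -- than the left side: one loses a leaf, the other a node. So they share the denominator r, which
  -- `reduced` cancels; `absorption` then passes from r to r + 1.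
  H⇒F : ∀ {m} → ClosedH m → ClosedF (suc m)
  H⇒F {m} h zero q a {p = p} refl _ = trans (cong (p *_) (F-rootless a (m + q * ℓ) (suc m))) (*-zeroʳ p)
  H⇒F {m} h (suc k) q a {t} {p} t≡ p≡ = subst₂ (λ t p → p * F a t (suc k) (suc m) ≡ suc k * ((p C suc m) * w))
      (sym (trans t≡ (t-suc k m (q * ℓ)))) (sym (trans p≡ (p-suc k m (q * ℓ))))
      (*-cancelˡ-≡ _ _ (suc m) (begin
        suc m * (suc r * x)                          ≡⟨ lemma₄ m r x ⟩
        suc r * (suc m * x)                          ≡⟨ cong (suc r *_) reduced ⟩
        suc r * (suc k * ((r C m) * w))              ≡⟨ lemma₅ r k (r C m) w ⟩
        suc k * ((suc r * (r C m)) * w)              ≡⟨ cong (λ z → suc k * (z * w)) (absorption r m) ⟨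
        suc k * ((suc m * (suc r C suc m)) * w)      ≡⟨ lemma₆ k m (suc r C suc m) w ⟩
        suc m * (suc k * ((suc r C suc m) * w))      ∎))
    where
    s r w x : ℕ
    s = 1 + k + m + q * ℓ
    r = 2 + k + (m + m) + q * ℓ
    w = weakCompositions (suc m) q
    x = F a (suc s) (suc k) (suc m)
    t-suc : ∀ k m z → suc k + suc m + z ≡ suc (1 + k + m + z)
    t-suc = solve-∀
    p-suc : ∀ k m z → suc k + (suc m + suc m) + z ≡ suc (2 + k + (m + m) + z)
    p-suc = solve-∀
    s-eq : ∀ k m z → 1 + k + m + z ≡ k + suc m + z
    s-eq = solve-∀
    r-eq : ∀ k m z → 2 + k + (m + m) + z ≡ k + (suc m + suc m) + z
    r-eq = solve-∀
    lemma₁ : ∀ r m x y → r * (suc m * (x + y)) ≡ suc m * (r * x) + suc m * (r * y)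
    lemma₁ = solve-∀
    lemma₂ : ∀ m k c d w r → suc m * (k * (d * w)) + (c * w) * (r + k * m)
      ≡ k * w * (suc m * d + m * c) + c * w * r
    lemma₂ = solve-∀
    lemma₃ : ∀ k w r c → k * w * (r * c) + c * w * r ≡ r * (suc k * (c * w))
    lemma₃ = solve-∀
    lemma₄ : ∀ m r x → suc m * (suc r * x) ≡ suc r * (suc m * x)
    lemma₄ = solve-∀
    lemma₅ : ∀ r k c w → suc r * (suc k * (c * w)) ≡ suc k * ((suc r * c) * w)
    lemma₅ = solve-∀
    lemma₆ : ∀ k m d w → suc k * ((suc m * d) * w) ≡ suc m * (suc k * (d * w))
    lemma₆ = solve-∀
    reduced : suc m * x ≡ suc k * ((r C m) * w)
    reduced = *-cancelˡ-≡ _ _ r (begin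
      r * (suc m * x)
        ≡⟨ cong (λ z → r * (suc m * z)) (F-step a s k m) ⟩
      r * (suc m * (F (suc a) s k (suc m) + H a (suc s) k m))
        ≡⟨ lemma₁ r m (F (suc a) s k (suc m)) (H a (suc s) k m) ⟩
      suc m * (r * F (suc a) s k (suc m)) + suc m * (r * H a (suc s) k m)
        ≡⟨ cong₂ _+_ (cong (suc m *_) (H⇒F h k q (suc a) (s-eq k m (q * ℓ)) (r-eq k m (q * ℓ)))) (h q k a refl refl) ⟩
      suc m * (k * ((r C suc m) * w)) + ((r C m) * w) * (r + k * m)
        ≡⟨ lemma₂ m k (r C m) (r C suc m) w r ⟩
      k * w * (suc m * (r C suc m) + m * (r C m)) + (r C m) * w * r
        ≡⟨ cong (λ z → k * w * z + (r C m) * w * r) (absorption-upper r m) ⟩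
      k * w * (r * (r C m)) + (r C m) * w * r
        ≡⟨ lemma₃ k w r (r C m) ⟩
      r * (suc k * ((r C m) * w)) ∎)

  closedF : ∀ m → ClosedF m
  closedF zero    = closedF-0
  closedF (suc m) = H⇒F (F⇒H (closedF m))

  -- For k = 1 the closed form has the denominator n + m + 2, with n = m + 1 + q ℓ; `key` exchanges
  -- it for n + 1.
  F-tree : ∀ a m q →
    suc (suc m + q * ℓ) * F a (suc (suc m + q * ℓ)) 1 (suc m) ≡ ((m + q) C m) * ((suc m + q * ℓ + suc m) C suc m)
  F-tree a m q = *-cancelˡ-≡ _ _ (suc p) (begin
    suc p * (suc n * x)                    ≡⟨ lemma₁ p n x ⟩
    suc n * (suc p * x)                    ≡⟨ cong (suc n *_) (closedF (suc m) 1 q a {p = suc p} refl (lemma₄ m (q * ℓ))) ⟩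
    suc n * (1 * ((suc p C suc m) * w))    ≡⟨ lemma₂ n (suc p C suc m) w ⟩
    w * (suc n * (suc p C suc m))          ≡⟨ cong (w *_) key ⟩
    w * (suc p * (p C suc m))              ≡⟨ lemma₃ w p (p C suc m) ⟩
    suc p * (w * (p C suc m))              ∎)
    where
    n = suc m + q * ℓ
    p = n + suc m
    w = (m + q) C m
    x = F a (suc n) 1 (suc m)
    lemma₁ : ∀ p n x → suc p * (suc n * x) ≡ suc n * (suc p * x)
    lemma₁ = solve-∀
    lemma₂ : ∀ n c w → suc n * (1 * (c * w)) ≡ w * (suc n * c)
    lemma₂ = solve-∀
    lemma₃ : ∀ w p c → w * (suc p * c) ≡ suc p * (w * c)
    lemma₃ = solve-∀
    lemma₄ : ∀ m z → suc (suc m + z + suc m) ≡ 1 + (suc m + suc m) + z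
    lemma₄ = solve-∀
    lemma₅ : ∀ n m c → suc n * c + suc m * c ≡ suc (n + suc m) * c
    lemma₅ = solve-∀
    -- Since n + 1 = (p + 1) - (m + 1), this is absorption in the complementary index; the term
    -- added on both sides avoids the subtraction.
    key : suc n * (suc p C suc m) ≡ suc p * (p C suc m)
    key = +-cancelʳ-≡ (suc m * (suc p C suc m)) _ _ (begin
      suc n * (suc p C suc m) + suc m * (suc p C suc m)  ≡⟨ lemma₅ n m (suc p C suc m) ⟩
      suc p * (suc p C suc m)                            ≡⟨ cong (suc p *_) (nCk+nC[k+1]≡[n+1]C[k+1] p m) ⟨
      suc p * (p C m + p C suc m)                        ≡⟨ lemma₆ (suc p) (p C m) (p C suc m) ⟩
      suc p * (p C suc m) + suc p * (p C m)              ≡⟨ cong (suc p * (p C suc m) +_) (absorption p m) ⟨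
      suc p * (p C suc m) + suc m * (suc p C suc m)      ∎)
      where
      lemma₆ : ∀ p x y → p * (x + y) ≡ p * y + p * x
      lemma₆ = solve-∀

-- Sorted vertex lists and cells

Sorted : List ℕ → Set
Sorted = AllPairs _<_

head-≤ : ∀ {x xs v} → Sorted (x ∷ xs) → v ∈ x ∷ xs → x ≤ v
head-≤ _        (here refl) = ≤-refl
head-≤ (px ∷ _) (there v∈)  = <⇒≤ (All.lookup px v∈)

≤-lastOf : ∀ {x xs v} → Sorted (x ∷ xs) → v ∈ x ∷ xs → v ≤ lastOf x xs
≤-lastOf {xs = []}     _         (here refl) = ≤-refl
≤-lastOf {xs = y ∷ ys} (px ∷ ps) (here refl) = ≤-trans (<⇒≤ (All.head px)) (≤-lastOf ps (here refl))
≤-lastOf {xs = y ∷ ys} (px ∷ ps) (there v∈)  = ≤-lastOf ps v∈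

lastOf-∈ : ∀ x xs → lastOf x xs ∈ x ∷ xs
lastOf-∈ x []       = here refl
lastOf-∈ x (y ∷ ys) = there (lastOf-∈ y ys)

lastOf-++ : ∀ x ys z zs → lastOf x (ys ++ z ∷ zs) ≡ lastOf z zs
lastOf-++ x []       z zs = refl
lastOf-++ x (y ∷ ys) z zs = lastOf-++ y ys z zs

∈-tail : ∀ {x xs v} → x < v → v ∈ x ∷ xs → v ∈ xs
∈-tail x<v (here refl) = contradiction x<v (<-irrefl refl)
∈-tail x<v (there v∈)  = v∈

sorted-ext : ∀ {xs ys} → Sorted xs → Sorted ys →
  (∀ {v} → v ∈ xs → v ∈ ys) → (∀ {v} → v ∈ ys → v ∈ xs) → xs ≡ ys
sorted-ext {[]}     {[]}     _ _ _ _ = refl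
sorted-ext {[]}     {y ∷ ys} _ _ _ g with () ← g (here refl)
sorted-ext {x ∷ xs} {[]}     _ _ f _ with () ← f (here refl)
sorted-ext {x ∷ xs} {y ∷ ys} (px ∷ sx) (py ∷ sy) f g
  with refl ← ≤-antisym (head-≤ (px ∷ sx) (g (here refl))) (head-≤ (py ∷ sy) (f (here refl)))
  = cong (x ∷_) (sorted-ext sx sy (λ v∈ → ∈-tail (All.lookup px v∈) (f (there v∈)))
      (λ v∈ → ∈-tail (All.lookup py v∈) (g (there v∈))))

sorted-init : ∀ xs {b ys} → Sorted (xs ++ b ∷ ys) → Sorted (xs ++ b ∷ [])
sorted-init []       _        = [] ∷ []
sorted-init (x ∷ xs) (p ∷ ps) = All.tabulate (λ v∈ → All.lookup p (weaken v∈)) ∷ sorted-init xs ps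
  where
  weaken : ∀ {v b ys} → v ∈ xs ++ b ∷ [] → v ∈ xs ++ b ∷ ys
  weaken v∈ with ∈-++⁻ xs v∈
  ... | inj₁ v∈xs        = ∈-++⁺ˡ v∈xs
  ... | inj₂ (here refl) = ∈-++⁺ʳ xs (here refl)

sorted-tail : ∀ xs {ys} → Sorted (xs ++ ys) → Sorted ys
sorted-tail []       s       = s
sorted-tail (x ∷ xs) (_ ∷ s) = sorted-tail xs s

init-< : ∀ xs {b ys v} → Sorted (xs ++ b ∷ ys) → v ∈ xs → v < b
init-< (x ∷ xs) (p ∷ _) (here refl) = All.lookup p (∈-++⁺ʳ xs (here refl))
init-< (x ∷ xs) (_ ∷ s) (there v∈)  = init-< xs s v∈

adjacent-init : ∀ xs {b ys e} → e ∈ adjacentPairs (xs ++ b ∷ []) → e ∈ adjacentPairs (xs ++ b ∷ ys)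
adjacent-init (x ∷ [])     (here refl) = here refl
adjacent-init (x ∷ y ∷ xs) (here refl) = here refl
adjacent-init (x ∷ y ∷ xs) (there e∈)  = there (adjacent-init (y ∷ xs) e∈)

adjacent-tail : ∀ xs {b ys e} → e ∈ adjacentPairs (b ∷ ys) → e ∈ adjacentPairs (xs ++ b ∷ ys)
adjacent-tail []           e∈ = e∈
adjacent-tail (x ∷ [])     e∈ = there e∈
adjacent-tail (x ∷ y ∷ xs) e∈ = there (adjacent-tail (y ∷ xs) e∈)

adjacent⊆ordered : ∀ S {e} → e ∈ adjacentPairs S → e ∈ orderedPairs S
adjacent⊆ordered (x ∷ y ∷ ys) (here refl) = here refl
adjacent⊆ordered (x ∷ y ∷ ys) (there e∈)  = ∈-++⁺ʳ (map (x ,_) (y ∷ ys)) (adjacent⊆ordered (y ∷ ys) e∈)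

ordered⁻ : ∀ {S u w} → Sorted S → (u , w) ∈ orderedPairs S → u ∈ S × w ∈ S × u < w
ordered⁻ {x ∷ xs} (px ∷ ps) e∈ with ∈-++⁻ (map (x ,_) xs) e∈
... | inj₁ e∈map with w , w∈ , refl ← ∈-map⁻ (x ,_) e∈map = here refl , there w∈ , All.lookup px w∈
... | inj₂ e∈′ with u∈ , w∈ , u<w ← ordered⁻ ps e∈′ = there u∈ , there w∈ , u<w

ordered⁺ : ∀ {S u w} → Sorted S → u ∈ S → w ∈ S → u < w → (u , w) ∈ orderedPairs S
ordered⁺ _         (here refl) (here refl) u<w = contradiction u<w (<-irrefl refl)
ordered⁺ _         (here refl) (there w∈)  u<w = ∈-++⁺ˡ (∈-map⁺ _ w∈)
ordered⁺ (px ∷ _)  (there u∈)  (here refl) u<w = contradiction u<w (<-asym (All.lookup px u∈))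
ordered⁺ {x ∷ xs} (_ ∷ ps) (there u∈) (there w∈) u<w = ∈-++⁺ʳ (map (x ,_) xs) (ordered⁺ ps u∈ w∈ u<w)

adjacent-∈ : ∀ {S u w} → Sorted S → (u , w) ∈ adjacentPairs S → u ∈ S × w ∈ S × u < w
adjacent-∈ {S} s e∈ = ordered⁻ s (adjacent⊆ordered S e∈)

adjacent-gap : ∀ {S u v w} → Sorted S → (u , w) ∈ adjacentPairs S → v ∈ S → u < v → v < w → ⊥
adjacent-gap {x ∷ y ∷ ys} _        (here refl) (here refl) u<v v<w = <-irrefl refl u<v
adjacent-gap {x ∷ y ∷ ys} (_ ∷ ps) (here refl) (there v∈)  u<v v<w = <-irrefl refl (<-≤-trans v<w (head-≤ ps v∈))
adjacent-gap {x ∷ y ∷ ys} (px ∷ ps) (there e∈) (here refl) u<v v<w =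
  <-asym u<v (All.lookup px (proj₁ (adjacent-∈ ps e∈)))
adjacent-gap {x ∷ y ∷ ys} (_ ∷ ps) (there e∈)  (there v∈)  u<v v<w = adjacent-gap ps e∈ v∈ u<v v<w

locate : ∀ x xs {v} → x ≤ v → v ≤ lastOf x xs →
  v ∈ x ∷ xs ⊎ ∃₂ λ u w → (u , w) ∈ adjacentPairs (x ∷ xs) × u < v × v < w
locate x xs {v} x≤v v≤ with m≤n⇒m<n∨m≡n x≤v
... | inj₂ refl = inj₁ (here refl)
locate x []       x≤v v≤ | inj₁ x<v = contradiction (<-≤-trans x<v v≤) (<-irrefl refl)
locate x (y ∷ ys) {v} x≤v v≤ | inj₁ x<v with v <? y
... | yes v<y = inj₂ (x , y , here refl , x<v , v<y)
... | no  v≮y with locate y ys (≮⇒≥ v≮y) v≤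
...   | inj₁ v∈                      = inj₁ (there v∈)
...   | inj₂ (u , w , e∈ , u<v , v<w) = inj₂ (u , w , there e∈ , u<v , v<w)

ordered-split : ∀ {S u w} → Sorted S → (u , w) ∈ orderedPairs S →
  (u , w) ∈ adjacentPairs S ⊎ ∃ λ v → v ∈ S × u < v × v < w
ordered-split {x ∷ xs} (px ∷ ps) e∈ with ∈-++⁻ (map (x ,_) xs) e∈
ordered-split {x ∷ []}     (px ∷ ps) e∈ | inj₁ ()
ordered-split {x ∷ y ∷ ys} (px ∷ ps) e∈ | inj₁ (here refl) = inj₁ (here refl)
ordered-split {x ∷ y ∷ ys} (px ∷ ps@(py ∷ _)) e∈ | inj₁ (there e∈′)
  with w , w∈ , refl ← ∈-map⁻ (x ,_) e∈′
  = inj₂ (y , there (here refl) , All.head px , All.lookup py w∈)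
ordered-split {x ∷ []}     (px ∷ ps) e∈ | inj₂ ()
ordered-split {x ∷ y ∷ ys} (px ∷ ps) e∈ | inj₂ e∈′ with ordered-split ps e∈′
... | inj₁ adj                 = inj₁ (there adj)
... | inj₂ (v , v∈ , u<v , v<w) = inj₂ (v , there v∈ , u<v , v<w)

-- The side through which a cell faces the root edge. The value at the empty list is arbitrary, as
-- cells have at least three vertices.
top : List ℕ → Edge
top []       = 0 , 0
top (x ∷ xs) = x , lastOf x xs

top-≤ : ∀ {S v} → Sorted S → v ∈ S → proj₁ (top S) ≤ v × v ≤ proj₂ (top S)
top-≤ {x ∷ xs} s v∈ = head-≤ s v∈ , ≤-lastOf s v∈

locate-top : ∀ {S v n} → suc n ≤ length S → proj₁ (top S) ≤ v → v ≤ proj₂ (top S) →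
  v ∈ S ⊎ ∃₂ λ u w → (u , w) ∈ adjacentPairs S × u < v × v < w
locate-top {x ∷ xs} _ = locate x xs

top-wide : ∀ {S} → Sorted S → 3 ≤ length S →
  ∃ λ v → v ∈ S × proj₁ (top S) < v × v < proj₂ (top S)
top-wide {x ∷ y ∷ z ∷ zs} (px ∷ py ∷ s) _ =
  y , there (here refl) , All.head px , <-≤-trans (All.head py) (≤-lastOf s (here refl))
top-wide {x ∷ []}     _ (s≤s ())
top-wide {x ∷ y ∷ []} _ (s≤s (s≤s ()))

-- Here the root edge (0 , N ∸ 1) is a member of D, so that every cell has its longest side in D.
record Cell (D : List Edge) (S : List ℕ) : Set where
  field
    sorted : Sorted S
    long   : 3 ≤ length S
    closed : top S ∈ D
    sides  : ∀ {u w} → (u , w) ∈ adjacentPairs S → w ≡ suc u ⊎ (u , w) ∈ D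
    -- The vertex v between u and w excludes consecutive pairs, so that only chords and the longest
    -- side are concerned.
    empty  : ∀ {u v w} → (u , w) ∈ D → u ∈ S → v ∈ S → w ∈ S → u < v → v < w → (u , w) ≡ top S

-- Partial dissections and the invariant of their construction

-- A partial dissection on the vertices a, …, M; the vertices visible from outside are a ∷ chain.
record Config : Set where
  constructor config
  field
    edges : List Edge
    chain : List ℕ
    faces : List (List ℕ)

open Config

leaf : ℕ → Config → Config
leaf a (config D s Ks) = config D (a ∷ s) Ks

merge : ℕ → ℕ → Config → Maybe Config
merge a b (config D s Ks) with b ∈? s
... | no  _  = nothing
... | yes b∈ with ∈-∃++ b∈
...   | pre , post , _ = just (config ((a , b) ∷ D) (b ∷ post) ((a ∷ pre ++ b ∷ []) ∷ Ks))

-- The split of the chain at b sits in the index, so that matching refines the configuration itself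
-- and no equation has to be transported.
data MergeView (a b : ℕ) : Config → Maybe Config → Set where
  unmerged : ∀ {D s Ks} → b ∉ s → MergeView a b (config D s Ks) nothing
  merged   : ∀ {D Ks} pre post →
    MergeView a b (config D (pre ++ b ∷ post) Ks)
                  (just (config ((a , b) ∷ D) (b ∷ post) ((a ∷ pre ++ b ∷ []) ∷ Ks)))

mergeView : ∀ a b c → MergeView a b c (merge a b c)
mergeView a b (config D s Ks) with b ∈? s
... | no  b∉ = unmerged b∉
... | yes b∈ with ∈-∃++ b∈
...   | pre , post , refl = merged pre post

-- Closing a cell S hides |S| - 2 vertices from the chain, so this is the total number of hidden
-- vertices.
excess : List (List ℕ) → ℕ
excess Ks = sum (map (λ S → length S ∸ 2) Ks)

-- Only the case in which the first edge starts further left; quantifying over both orders recovers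
-- the symmetric test `crosses`.
Crossing : Edge → Edge → Set
Crossing (a , b) (c , d) = a < c × c < b × b < d

-- The chain is pinned down from both sides: `exposed` lets a be joined to a chain vertex without
-- crossing, and `covered` supplies the edge that obstructs any other vertex. With `unique`, the
-- fields `cell⁺` and `cell⁻` let number and sizes of the cells be read off `faces`; `balance` ties
-- these sizes to the length of the chain.
record Inv (M a : ℕ) (c : Config) : Set where
  open Config c renaming (edges to D; chain to s; faces to Ks)
  field
    sorted  : Sorted (a ∷ s)
    last    : lastOf a s ≡ M
    sides   : ∀ {u w} → (u , w) ∈ adjacentPairs (a ∷ s) → w ≡ suc u ⊎ (u , w) ∈ D
    bounds  : ∀ {u w} → (u , w) ∈ D → a ≤ u × 2 + u ≤ w × w ≤ M
    exposed : ∀ {u v w} → (u , w) ∈ D → v ∈ a ∷ s → u < v → v < w → ⊥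
    covered : ∀ {v} → a ≤ v → v ≤ M → v ∈ a ∷ s ⊎ ∃₂ λ u w → (u , w) ∈ D × u < v × v < w
    planar  : ∀ {e f} → e ∈ D → f ∈ D → ¬ Crossing e f
    unique  : Unique Ks
    cell⁺   : ∀ {S} → Cell D S → S ∈ Ks
    cell⁻   : ∀ {S} → S ∈ Ks → Cell D S
    balance : a + (length s + excess Ks) ≡ M

inv-start : ∀ M → Inv M M (config [] [] [])
inv-start M = record
  { sorted  = [] ∷ []
  ; last    = refl
  ; sides   = λ ()
  ; bounds  = λ ()
  ; exposed = λ ()
  ; covered = λ M≤v v≤M → inj₁ (here (≤-antisym v≤M M≤v))
  ; planar  = λ ()
  ; unique  = []
  ; cell⁺   = λ c → absurd (Cell.closed c)
  ; cell⁻   = λ ()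
  ; balance = +-identityʳ M
  }
  where
  absurd : ∀ {A : Set} {e : Edge} → e ∈ [] → A
  absurd ()

inv-leaf : ∀ {M a c} → Inv M (suc a) c → Inv M a (leaf (suc a) c)
inv-leaf {M} {a} {config D s Ks} inv = record
  { sorted  = All.tabulate (head-≤ I.sorted) ∷ I.sorted
  ; last    = I.last
  ; sides   = λ { (here refl) → inj₁ refl ; (there e∈) → I.sides e∈ }
  ; bounds  = λ e∈ → let p , q = I.bounds e∈ in <⇒≤ p , q
  ; exposed = λ { e∈ (here refl) u<v _ → <-asym u<v (proj₁ (I.bounds e∈))
                ; e∈ (there v∈) → I.exposed e∈ v∈ }
  ; covered = covered′
  ; planar  = I.planar
  ; unique  = I.unique
  ; cell⁺   = I.cell⁺
  ; cell⁻   = I.cell⁻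
  ; balance = trans (+-suc a _) I.balance
  }
  where
  module I = Inv inv
  covered′ : ∀ {v} → a ≤ v → v ≤ M → v ∈ a ∷ suc a ∷ s ⊎ ∃₂ λ u w → (u , w) ∈ D × u < v × v < w
  covered′ a≤v v≤M with m≤n⇒m<n∨m≡n a≤v
  ... | inj₂ refl = inj₁ (here refl)
  ... | inj₁ a<v with I.covered a<v v≤M
  ...   | inj₁ v∈ = inj₁ (there v∈)
  ...   | inj₂ r  = inj₂ r

-- The hypothesis `fresh` expresses that the edges at a are added with ascending right ends.
-- Together with `bounds` it prevents any earlier edge from enclosing (a , b).
module Merge {M a b : ℕ} {D : List Edge} {pre post : List ℕ} {Ks : List (List ℕ)} (2+a≤b : 2 + a ≤ b)
  (inv : Inv M a (config D (pre ++ b ∷ post) Ks))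
  (fresh : ∀ {w} → (a , w) ∈ D → w < b) where

  private module I = Inv inv

  D′ : List Edge
  D′ = (a , b) ∷ D

  old new : List ℕ
  old = a ∷ pre ++ b ∷ post
  new = a ∷ pre ++ b ∷ []

  a<b : a < b
  a<b = <⇒≤ 2+a≤b

  b∈old : b ∈ old
  b∈old = ∈-++⁺ʳ (a ∷ pre) (here refl)

  new⊆old : ∀ {v} → v ∈ new → v ∈ old × v ≤ b
  new⊆old v∈ with ∈-++⁻ (a ∷ pre) v∈
  ... | inj₁ v∈l         = ∈-++⁺ˡ v∈l , <⇒≤ (init-< (a ∷ pre) I.sorted v∈l)
  ... | inj₂ (here refl) = b∈old , ≤-refl

  post⊆old : ∀ {v} → v ∈ b ∷ post → v ∈ old
  post⊆old = ∈-++⁺ʳ (a ∷ pre)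

  post-≥ : ∀ {v} → v ∈ b ∷ post → b ≤ v
  post-≥ = head-≤ (sorted-tail (a ∷ pre) I.sorted)

  old⊆new : ∀ {v} → v ∈ old → v ≤ b → v ∈ new
  old⊆new v∈ v≤b with ∈-++⁻ (a ∷ pre) v∈
  ... | inj₁ v∈l = ∈-++⁺ˡ v∈l
  ... | inj₂ v∈r with refl ← ≤-antisym v≤b (post-≥ v∈r) = ∈-++⁺ʳ (a ∷ pre) (here refl)

  top-new : top new ≡ (a , b)
  top-new = cong (a ,_) (lastOf-++ a pre b [])

  -- Otherwise a and b would be neighbours on the chain, hence joined by a side, against 2 + a ≤ b,
  -- or by an earlier edge, against `fresh`.
  pre-nonempty : 1 ≤ length pre
  pre-nonempty = go refl
    where
    go : ∀ {xs} → xs ≡ pre → 1 ≤ length xs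
    go {_ ∷ _} _ = s≤s z≤n
    go {[]} refl with I.sides (here refl)
    ... | inj₁ refl = contradiction 2+a≤b (<-irrefl refl)
    ... | inj₂ e∈   = contradiction (fresh e∈) (<-irrefl refl)

  length-new : length new ≡ 2 + length pre
  length-new = cong suc (trans (length-++ pre) (+-comm (length pre) 1))

  new-cell : Cell D′ new
  new-cell = record
    { sorted = sorted-init (a ∷ pre) I.sorted
    ; long   = subst (3 ≤_) (sym length-new) (s≤s (s≤s pre-nonempty))
    ; closed = here top-new
    ; sides  = λ e∈ → map₂ there (I.sides (adjacent-init (a ∷ pre) e∈))
    ; empty  = λ { (here refl) _ _ _ _ _ → sym top-new
                 ; (there e∈) _ v∈ _ u<v v<w → ⊥-elim (I.exposed e∈ (proj₁ (new⊆old v∈)) u<v v<w) }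
    }

  -- The longest side (u , w) satisfies u ≤ a and b ≤ w. Then `bounds` forces u = a, and `fresh`
  -- gives w < b.
  not-enclosed : ∀ {S} → Sorted S → top S ∈ D → a ∈ S → b ∈ S → ⊥
  not-enclosed {S} s e∈ a∈ b∈
    with top S | top-≤ s a∈ | top-≤ s b∈
  ... | u , w | u≤a , _ | _ , b≤w
    with refl ← ≤-antisym u≤a (proj₁ (I.bounds e∈))
    = contradiction (<-≤-trans (fresh e∈) b≤w) (<-irrefl refl)

  -- An old cell could be lost only if (a , b) became a chord of it, but no old cell contains both a
  -- and b.
  cell-extend : ∀ {S} → Cell D S → Cell D′ S
  cell-extend {S} c = record
    { sorted = C.sorted
    ; long   = C.long
    ; closed = there C.closed
    ; sides  = λ e∈ → map₂ there (C.sides e∈)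
    ; empty  = λ { (here refl) u∈ _ w∈ _ _ → ⊥-elim (not-enclosed C.sorted C.closed u∈ w∈)
                 ; (there e∈) → C.empty e∈ }
    }
    where module C = Cell c

  cell-restrict : ∀ {S} → Cell D′ S → top S ∈ D → Cell D S
  cell-restrict {S} c top∈ = record
    { sorted = C.sorted
    ; long   = C.long
    ; closed = top∈
    ; sides  = sides′
    ; empty  = λ e∈ → C.empty (there e∈)
    }
    where
    module C = Cell c
    sides′ : ∀ {u w} → (u , w) ∈ adjacentPairs S → w ≡ suc u ⊎ (u , w) ∈ D
    sides′ e∈ with C.sides e∈
    ... | inj₁ unit        = inj₁ unit
    ... | inj₂ (there e∈D) = inj₂ e∈D
    ... | inj₂ (here refl) =
      let a∈ , b∈ , _ = adjacent-∈ C.sorted e∈ in ⊥-elim (not-enclosed C.sorted top∈ a∈ b∈)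

  module _ {S : List ℕ} (c : Cell D′ S) (top≡ : top S ≡ (a , b)) where
    private module C = Cell c

    locate-S : ∀ {v} → a ≤ v → v ≤ b → v ∈ S ⊎ ∃₂ λ u w → (u , w) ∈ adjacentPairs S × u < v × v < w
    locate-S {v} a≤v v≤b =
      locate-top C.long (subst (λ e → proj₁ e ≤ v) (sym top≡) a≤v) (subst (λ e → v ≤ proj₂ e) (sym top≡) v≤b)

    in-range : ∀ {v} → v ∈ S → a ≤ v × v ≤ b
    in-range {v} v∈ = subst (λ e → proj₁ e ≤ v × v ≤ proj₂ e) top≡ (top-≤ C.sorted v∈)

    -- If both ends of the edge are in S, `empty` makes it equal to (a , b), against `fresh`. If one
    -- end lies strictly under a side of S, that side belongs to D, since a unit side has nothing
    -- under it and (a , b) cannot be a consecutive pair with v in between; the edge then crosses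
    -- this side.
    S-exposed : ∀ {u v w} → (u , w) ∈ D → v ∈ S → u < v → v < w → ⊥
    S-exposed {u} {v} {w} e∈ v∈ u<v v<w = go (locate-S a≤u u≤b) (locate-S a≤w w≤b)
      where
      a≤u : a ≤ u
      a≤u = proj₁ (I.bounds e∈)
      u<b : u < b
      u<b = <-≤-trans u<v (proj₂ (in-range v∈))
      u≤b : u ≤ b
      u≤b = <⇒≤ u<b
      w≤b : w ≤ b
      w≤b = ≮⇒≥ (λ b<w → I.exposed e∈ b∈old u<b b<w)
      a≤w : a ≤ w
      a≤w = ≤-trans a≤u (<⇒≤ (<-trans u<v v<w))
      root-side : ∀ {x y} → (x , y) ∈ adjacentPairs S → (x , y) ≡ (a , b) → ⊥
      root-side adj refl = adjacent-gap C.sorted adj v∈ (≤-<-trans a≤u u<v) (<-≤-trans v<w w≤b)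
      go : (u ∈ S ⊎ ∃₂ λ x y → (x , y) ∈ adjacentPairs S × x < u × u < y) →
           (w ∈ S ⊎ ∃₂ λ x y → (x , y) ∈ adjacentPairs S × x < w × w < y) → ⊥
      go (inj₁ u∈) (inj₁ w∈) with refl ← trans (C.empty (there e∈) u∈ v∈ w∈ u<v v<w) top≡
        = <-irrefl refl (fresh e∈)
      go (inj₂ (x , y , adj , x<u , u<y)) _ with C.sides adj
      ... | inj₁ refl        = <-irrefl refl (<-≤-trans u<y x<u)
      ... | inj₂ (here eq)   = root-side adj eq
      ... | inj₂ (there f∈)  = I.planar f∈ e∈ (x<u , u<y ,
        ≤-<-trans (≮⇒≥ (adjacent-gap C.sorted adj v∈ (<-trans x<u u<v))) v<w)
      go _ (inj₂ (x , y , adj , x<w , w<y)) with C.sides adj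
      ... | inj₁ refl        = <-irrefl refl (<-≤-trans w<y x<w)
      ... | inj₂ (here eq)   = root-side adj eq
      ... | inj₂ (there f∈)  = I.planar e∈ f∈
        (<-≤-trans u<v (≮⇒≥ (λ x<v → adjacent-gap C.sorted adj v∈ x<v (<-trans v<w w<y))) , x<w , w<y)

    -- A vertex of S outside `new` would be covered by an edge of D, against `S-exposed`. A vertex
    -- of `new` outside S would lie under a side of S, against `exposed`.
    new-unique : S ≡ new
    new-unique = sorted-ext C.sorted (sorted-init (a ∷ pre) I.sorted) S⊆new new⊆S
      where
      b≤M : b ≤ M
      b≤M = subst (b ≤_) I.last (≤-lastOf I.sorted b∈old)
      S⊆new : ∀ {v} → v ∈ S → v ∈ new
      S⊆new v∈ with in-range v∈
      ... | a≤v , v≤b with I.covered a≤v (≤-trans v≤b b≤M)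
      ...   | inj₁ v∈old = old⊆new v∈old v≤b
      ...   | inj₂ (u , w , e∈ , u<v , v<w) = ⊥-elim (S-exposed e∈ v∈ u<v v<w)
      new⊆S : ∀ {v} → v ∈ new → v ∈ S
      new⊆S v∈ with new⊆old v∈
      ... | v∈old , v≤b with locate-S (head-≤ I.sorted v∈old) v≤b
      ...   | inj₁ v∈S = v∈S
      ...   | inj₂ (u , w , adj , u<v , v<w) with C.sides adj
      ...     | inj₁ refl       = ⊥-elim (<-irrefl refl (<-≤-trans v<w u<v))
      ...     | inj₂ (there e∈) = ⊥-elim (I.exposed e∈ v∈old u<v v<w)
      -- The longest side is not a consecutive pair, because a cell has a third vertex strictly
      -- between its extremes.
      ...     | inj₂ (here eq)  with y , y∈ , x<y , y<z ← top-wide C.sorted C.long =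
        ⊥-elim (adjacent-gap C.sorted (subst (_∈ adjacentPairs S) (trans eq (sym top≡)) adj) y∈ x<y y<z)

  inv-merge : Inv M a (config D′ (b ∷ post) (new ∷ Ks))
  inv-merge = record
    { sorted  = All.tabulate (λ v∈ → <-≤-trans a<b (post-≥ v∈)) ∷ sorted-tail (a ∷ pre) I.sorted
    ; last    = trans (sym (lastOf-++ a pre b post)) I.last
    ; sides   = λ { (here refl) → inj₂ (here refl)
                  ; (there e∈) → map₂ there (I.sides (adjacent-tail (a ∷ pre) e∈)) }
    ; bounds  = λ { (here refl) → ≤-refl , 2+a≤b , subst (b ≤_) I.last (≤-lastOf I.sorted b∈old)
                  ; (there e∈) → I.bounds e∈ }
    ; exposed = exposed′
    ; covered = covered′
    ; planar  = planar′
    -- Were `new` among the old cells, its longest side (a , b) would already be in D.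
    ; unique  = ¬Any⇒All¬ Ks (λ new∈ → <-irrefl refl (fresh (subst (_∈ D) top-new (Cell.closed (I.cell⁻ new∈))))) ∷ I.unique
    ; cell⁺   = cell⁺′
    ; cell⁻   = λ { (here refl) → new-cell ; (there S∈) → cell-extend (I.cell⁻ S∈) }
    ; balance = trans (cong (a +_) balance′) I.balance
    }
    where
    exposed′ : ∀ {u v w} → (u , w) ∈ D′ → v ∈ a ∷ b ∷ post → u < v → v < w → ⊥
    exposed′ (here refl) (here refl) u<v _   = <-irrefl refl u<v
    exposed′ (here refl) (there v∈)  _   v<w = <-irrefl refl (<-≤-trans v<w (post-≥ v∈))
    exposed′ (there e∈)  (here refl) = I.exposed e∈ (here refl)
    exposed′ (there e∈)  (there v∈)  = I.exposed e∈ (post⊆old v∈)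
    covered′ : ∀ {v} → a ≤ v → v ≤ M → v ∈ a ∷ b ∷ post ⊎ ∃₂ λ u w → (u , w) ∈ D′ × u < v × v < w
    covered′ {v} a≤v v≤M with I.covered a≤v v≤M
    ... | inj₂ (u , w , e∈ , p) = inj₂ (u , w , there e∈ , p)
    ... | inj₁ (here refl) = inj₁ (here refl)
    ... | inj₁ (there v∈) with ∈-++⁻ pre v∈
    ...   | inj₂ v∈r = inj₁ (there v∈r)
    ...   | inj₁ v∈l = inj₂ (a , b , here refl , All.lookup (AllPairs.head I.sorted) v∈ , init-< (a ∷ pre) I.sorted (there v∈l))
    planar′ : ∀ {e f} → e ∈ D′ → f ∈ D′ → ¬ Crossing e f
    planar′ (here refl) (here refl) (p , _)     = <-irrefl refl p
    planar′ (here refl) (there f∈)  (_ , p , q) = I.exposed f∈ b∈old p q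
    planar′ (there e∈)  (here refl) (p , _)     = <-irrefl refl (<-≤-trans p (proj₁ (I.bounds e∈)))
    planar′ (there e∈)  (there f∈)              = I.planar e∈ f∈
    cell⁺′ : ∀ {S} → Cell D′ S → S ∈ new ∷ Ks
    cell⁺′ c with Cell.closed c
    ... | here eq   = here (new-unique c eq)
    ... | there e∈  = there (I.cell⁺ (cell-restrict c e∈))
    balance′ : length (b ∷ post) + excess (new ∷ Ks) ≡ length (pre ++ b ∷ post) + excess Ks
    balance′ = begin
      suc (length post) + (length new ∸ 2 + excess Ks)     ≡⟨ cong (λ z → suc (length post) + (z ∸ 2 + excess Ks)) length-new ⟩
      suc (length post) + (length pre + excess Ks)         ≡⟨ +-assoc (suc (length post)) (length pre) (excess Ks) ⟨
      suc (length post) + length pre + excess Ks           ≡⟨ cong (_+ excess Ks) (+-comm (suc (length post)) (length pre)) ⟩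
      length pre + suc (length post) + excess Ks           ≡⟨ cong (_+ excess Ks) (length-++ pre) ⟨
      length (pre ++ b ∷ post) + excess Ks                 ∎
      where open ≡-Reasoning

-- Counting configurations

indicator : Bool → ℕ
indicator b = if b then 1 else 0

indicator-0 : ∀ {p} → ¬ T p → indicator p ≡ 0
indicator-0 {false} _  = refl
indicator-0 {true}  ¬p = contradiction _ ¬p

indicator-⊎ : ∀ {p q r} → (T p → T q ⊎ T r) → (T q → T p) → (T r → T p) → (T q → T r → ⊥) →
  indicator p ≡ indicator q + indicator r
indicator-⊎ {p}     {true}  {true}  _ _ _ d = contradiction _ (d _)
indicator-⊎ {true}  {true}  {false} _ _ _ _ = refl
indicator-⊎ {true}  {false} {true}  _ _ _ _ = refl
indicator-⊎ {true}  {false} {false} f _ _ _ with f _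
... | inj₁ ()
... | inj₂ ()
indicator-⊎ {false} {true}  {false} _ g _ _ = contradiction _ g
indicator-⊎ {false} {false} {true}  _ _ h _ = contradiction _ h
indicator-⊎ {false} {false} {false} _ _ _ _ = refl

T-ext : ∀ {p q} → (T p → T q) → (T q → T p) → p ≡ q
T-ext {true}  {true}  _ _ = refl
T-ext {true}  {false} f _ = ⊥-elim (f _)
T-ext {false} {true}  _ g = ⊥-elim (g _)
T-ext {false} {false} _ _ = refl

count : (A → Bool) → List A → ℕ
count p []       = 0
count p (x ∷ xs) = indicator (p x) + count p xs

length-filterᵇ : (p : A → Bool) → ∀ xs → length (filterᵇ p xs) ≡ count p xs
length-filterᵇ p [] = refl
length-filterᵇ p (x ∷ xs) with p x
... | true  = cong suc (length-filterᵇ p xs)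
... | false = length-filterᵇ p xs

count-++ : (p : A → Bool) → ∀ xs ys → count p (xs ++ ys) ≡ count p xs + count p ys
count-++ p []       ys = refl
count-++ p (x ∷ xs) ys = trans (cong (indicator (p x) +_) (count-++ p xs ys)) (sym (+-assoc (indicator (p x)) _ _))

count-map : (p : B → Bool) (f : A → B) → ∀ xs → count p (map f xs) ≡ count (p ∘ f) xs
count-map p f []       = refl
count-map p f (x ∷ xs) = cong (indicator (p (f x)) +_) (count-map p f xs)

count-mapMaybe : (p : B → Bool) (f : A → Maybe B) → ∀ xs →
  count p (mapMaybe f xs) ≡ count (maybe′ p false ∘ f) xs
count-mapMaybe p f [] = refl
count-mapMaybe p f (x ∷ xs) with f x
... | just y  = cong (indicator (p y) +_) (count-mapMaybe p f xs)
... | nothing = count-mapMaybe p f xs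

count-cong : {p q : A → Bool} → ∀ {xs} → All (λ x → p x ≡ q x) xs → count p xs ≡ count q xs
count-cong []         = refl
count-cong (eq ∷ eqs) = cong₂ _+_ (cong indicator eq) (count-cong eqs)

count-0 : {p : A → Bool} → ∀ {xs} → All (λ x → ¬ T (p x)) xs → count p xs ≡ 0
count-0 []        = refl
count-0 (np ∷ ps) = cong₂ _+_ (indicator-0 np) (count-0 ps)

+-interchange : ∀ a b c d → a + b + (c + d) ≡ a + c + (b + d)
+-interchange = solve-∀

count-+ : {p q r : A → Bool} → ∀ {xs} → All (λ x → indicator (p x) ≡ indicator (q x) + indicator (r x)) xs →
  count p xs ≡ count q xs + count r xs
count-+ []         = refl
count-+ {p = p} {q} {r} {x ∷ xs} (eq ∷ eqs) =
  trans (cong₂ _+_ eq (count-+ {p = p} {q} {r} eqs))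
    (+-interchange (indicator (q x)) (indicator (r x)) (count q xs) (count r xs))

mapMaybe-All : ∀ {P : A → Set} {Q : B → Set} {f : A → Maybe B} →
  (∀ {x y} → P x → f x ≡ just y → Q y) → ∀ {xs} → All P xs → All Q (mapMaybe f xs)
mapMaybe-All h [] = []
mapMaybe-All {f = f} h {x ∷ xs} (px ∷ pxs) with f x in eq
... | just y  = h px eq ∷ mapMaybe-All h pxs
... | nothing = mapMaybe-All h pxs

count-all : ∀ {p : A → Bool} {xs} → All (T ∘ p) xs → count p xs ≡ length xs
count-all [] = refl
count-all {p = p} {x ∷ xs} (px ∷ pxs) with p x
... | true = cong suc (count-all pxs)

above : ℕ → List ℕ → ℕ
above b = count (b <ᵇ_)

-- When the threshold passes a chain vertex, the count drops by exactly one; by `above-∉` it is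
-- otherwise unchanged. This charges each configuration to a single b.
above-sorted : ∀ b′ pre {post} → Sorted (pre ++ suc b′ ∷ post) →
  above b′ (pre ++ suc b′ ∷ post) ≡ suc (length post) × above (suc b′) (pre ++ suc b′ ∷ post) ≡ length post
above-sorted b′ pre {post} s =
  trans (count-++ (b′ <ᵇ_) pre _) (cong₂ _+_ pre-0
      (count-all {xs = suc b′ ∷ post}
        (<⇒<ᵇ (n<1+n b′) ∷ All.map (<⇒<ᵇ ∘ <-trans (n<1+n b′)) (AllPairs.head tail)))) ,
  trans (count-++ (suc b′ <ᵇ_) pre _) (cong₂ _+_ pre-0′
      (cong₂ _+_ (indicator-0 {suc b′ <ᵇ suc b′} (<-irrefl refl ∘ <ᵇ⇒< (suc b′) (suc b′)))
        (count-all (All.map <⇒<ᵇ (AllPairs.head tail)))))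
  where
  tail : Sorted (suc b′ ∷ post)
  tail = sorted-tail pre s
  pre-0 : above b′ pre ≡ 0
  pre-0 = count-0 (All.tabulate (λ v∈ t → <-irrefl refl (<-≤-trans (<ᵇ⇒< _ _ t) (≤-pred (init-< pre s v∈)))))
  pre-0′ : above (suc b′) pre ≡ 0
  pre-0′ = count-0 (All.tabulate (λ v∈ t → <-asym (<ᵇ⇒< _ _ t) (init-< pre s v∈)))

above-∉ : ∀ b′ {s} → suc b′ ∉ s → above (suc b′) s ≡ above b′ s
above-∉ b′ b∉ = count-cong (All.tabulate (λ {v} v∈ → T-ext
  (λ t → <⇒<ᵇ (<-trans (n<1+n b′) (<ᵇ⇒< (suc b′) v t)))
  (λ t → <⇒<ᵇ (≤∧≢⇒< (<ᵇ⇒< b′ v t) λ { refl → b∉ v∈ }))))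

-- Decides the edges (a , a + 2), ..., (a , a + j + 1). The order, chosen edges before omitted ones,
-- copies `sublists`, so that the comparison with non-crossing edge sets is an equality of lists. In
-- `configs` the last edge of each block ends at the last vertex; for a = 0 it is the root edge.
blockConfigs : ℕ → ℕ → List Config → List Config
blockConfigs a zero    cs = cs
blockConfigs a (suc j) cs = mapMaybe (merge a (suc (suc (a + j)))) (blockConfigs a j cs) ++ blockConfigs a j cs

configs : ℕ → ℕ → List Config
configs a zero    = config [] [] [] ∷ []
configs a (suc t) = blockConfigs a t (map (leaf (suc a)) (configs (suc a) t))

Fresh : ℕ → ℕ → Config → Set
Fresh a b c = ∀ {w} → (a , w) ∈ edges c → w < b

inv-block : ∀ {M a cs} j → All (Inv M (suc a)) cs →
  All (λ c → Inv M a c × Fresh a (suc (suc (a + j))) c) (blockConfigs a j (map (leaf (suc a)) cs))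
inv-block {M} {a} zero invs = map⁺ (All.map start invs)
  where
  start : ∀ {c} → Inv M (suc a) c → Inv M a (leaf (suc a) c) × Fresh a (suc (suc (a + 0))) (leaf (suc a) c)
  start i = inv-leaf i , λ e∈ → contradiction (proj₁ (Inv.bounds i e∈)) (<-irrefl refl)
inv-block {M} {a} {cs} (suc j) invs = ++⁺ (mapMaybe-All step ih) (All.map weaken ih)
  where
  b b⁺ : ℕ
  b  = suc (suc (a + j))
  b⁺ = suc (suc (a + suc j))
  b<b⁺ : b < b⁺
  b<b⁺ = s≤s (s≤s (≤-reflexive (sym (+-suc a j))))
  ih : All (λ c → Inv M a c × Fresh a b c) (blockConfigs a j (map (leaf (suc a)) cs))
  ih = inv-block j invs
  weaken : ∀ {c} → Inv M a c × Fresh a b c → Inv M a c × Fresh a b⁺ c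
  weaken (i , fresh) = i , λ e∈ → <-trans (fresh e∈) b<b⁺
  step : ∀ {c c′} → Inv M a c × Fresh a b c → merge a b c ≡ just c′ → Inv M a c′ × Fresh a b⁺ c′
  step {c} (i , fresh) eq with merge a b c | mergeView a b c
  step (i , fresh) refl | _ | merged pre post =
    Merge.inv-merge (s≤s (s≤s (m≤m+n a j))) i fresh ,
    λ { (here refl) → b<b⁺ ; (there e∈) → <-trans (fresh e∈) b<b⁺ }

inv-configs : ∀ a t → All (Inv (a + t) a) (configs a t)
inv-configs a zero    = subst (λ M → Inv M a _) (sym (+-identityʳ a)) (inv-start a) ∷ []
inv-configs a (suc t) = All.map proj₁ (inv-block t
  (subst (λ M → All (Inv M (suc a)) (configs (suc a) t)) (sym (+-suc a t)) (inv-configs (suc a) t)))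

-- The forest numbers of the construction and their recursion

module Count (ℓ : ℕ) (0<ℓ : 0 < ℓ) where

  periodic : ℕ → Bool
  periodic z = (3 <ᵇ suc z) ∧ ⌊ ℓ ∣? (z ∸ 3) ⌋

  periodic⁻ : ∀ {z} → T (periodic z) → ∃ λ d → z ≡ 3 + d * ℓ
  periodic⁻ {z} t with Equivalence.to (T-∧ {3 <ᵇ suc z}) t
  ... | 3<z , w with divides d eq ← toWitness {a? = ℓ ∣? (z ∸ 3)} w =
    d , trans (sym (m+[n∸m]≡n (≤-pred (<ᵇ⇒< 3 (suc z) 3<z)))) (cong (3 +_) eq)

  periodic⁺ : ∀ d → T (periodic (3 + d * ℓ))
  periodic⁺ d = Equivalence.from T-∧ (_ , fromWitness {a? = ℓ ∣? (d * ℓ)} (divides d refl))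

  good : ℕ → List (List ℕ) → Bool
  good m Ks = (length Ks ≡ᵇ m) ∧ all (λ S → periodic (length S)) Ks

  excess-periodic : ∀ Ks → T (all (λ S → periodic (length S)) Ks) → ∃ λ q → excess Ks ≡ length Ks + q * ℓ
  excess-periodic [] _ = 0 , refl
  excess-periodic (S ∷ Ks) t with Equivalence.to T-∧ t
  ... | tS , tKs with periodic⁻ {length S} tS | excess-periodic Ks tKs
  ...   | d , eq | q , eq′ = d + q , trans (cong₂ _+_ (cong (_∸ 2) eq) eq′) (lemma d q ℓ (length Ks))
    where
    lemma : ∀ d q ℓ n → 1 + d * ℓ + (n + q * ℓ) ≡ 1 + n + (d + q) * ℓ
    lemma = solve-∀

  -- Each periodic cell hides 1 + d ℓ vertices; summing over the m cells in `balance` gives the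
  -- congruence between t and the chain length plus m.
  good-balance : ∀ {a t m c} → Inv (a + t) a c → T (good m (faces c)) → ∃ λ q → t ≡ length (chain c) + (m + q * ℓ)
  good-balance {a} {t} {m} {c} inv g with Equivalence.to T-∧ g
  ... | len , per with refl ← ≡ᵇ⇒≡ (length (faces c)) m len with excess-periodic (faces c) per
  ...   | q , eq = q , sym (trans (cong (length (chain c) +_) (sym eq)) (+-cancelˡ-≡ a _ _ (Inv.balance inv)))

  -- Joining a to the chain vertex with k vertices to its right closes a cell of |s| - k + 1
  -- vertices, a included, and leaves k + 1 chain edges.
  mergeable : ℕ → List ℕ → Bool
  mergeable k s = periodic (suc (length s ∸ k))

  mergeable⁻ : ∀ k s → T (mergeable k s) → ∃ λ d → length s ≡ 2 + k + d * ℓ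
  mergeable⁻ k s t with periodic⁻ {suc (length s ∸ k)} t
  ... | d , eq = d , (begin
    length s             ≡⟨ m∸n+n≡m {length s} {k} (<⇒≤ (m∸n≢0⇒n<m λ z → contradiction (trans (sym eq′) z) λ ())) ⟨
    length s ∸ k + k     ≡⟨ cong (_+ k) eq′ ⟩
    2 + d * ℓ + k        ≡⟨ lemma d k ℓ ⟩
    2 + k + d * ℓ        ∎)
    where
    open ≡-Reasoning
    eq′ : length s ∸ k ≡ 2 + d * ℓ
    eq′ = suc-injective eq
    lemma : ∀ d k ℓ → 2 + d * ℓ + k ≡ 2 + k + d * ℓ
    lemma = solve-∀

  mergeable⁺ : ∀ k s d → length s ≡ 2 + k + d * ℓ → T (mergeable k s)
  mergeable⁺ k s d eq = subst (T ∘ periodic ∘ suc) (sym (begin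
    length s ∸ k             ≡⟨ cong (_∸ k) (trans eq (lemma d k ℓ)) ⟩
    k + (2 + d * ℓ) ∸ k      ≡⟨ m+n∸m≡n k (2 + d * ℓ) ⟩
    2 + d * ℓ                ∎)) (periodic⁺ d)
    where
    open ≡-Reasoning
    lemma : ∀ d k ℓ → 2 + k + d * ℓ ≡ k + (2 + d * ℓ)
    lemma = solve-∀

  isForest : ℕ → ℕ → Config → Bool
  isForest k m c = good m (faces c) ∧ (length (chain c) ≡ᵇ k)

  isMergeable : ℕ → ℕ → Config → Bool
  isMergeable k m c = good m (faces c) ∧ mergeable k (chain c)

  F H : ℕ → ℕ → ℕ → ℕ → ℕ
  F a t k m = count (isForest k m) (configs a t)
  H a t k m = count (isMergeable k m) (configs a t)

  F-empty : ∀ a → F a 0 0 0 ≡ 1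
  F-empty a = refl

  F-rootless : ∀ a t m → F a (suc t) 0 m ≡ 0
  F-rootless a t m = count-0 (All.map nonempty (inv-configs a (suc t)))
    where
    nonempty : ∀ {c} → Inv (a + suc t) a c → ¬ T (isForest 0 m c)
    nonempty {config D [] Ks}      inv f = m≢1+m+n a (trans (Inv.last inv) (+-suc a t))
    nonempty {config D (x ∷ s) Ks} inv f with () ← proj₂ (Equivalence.to (T-∧ {good m Ks}) f)

  -- The term d = 0 is split off from the sum; it is disjoint from the rest because ℓ is positive.
  H-step : ∀ a t k m → H a t k m ≡ F a t (2 + k) m + H a t (k + ℓ) m
  H-step a t k m = count-+ (All.universal (λ c → indicator-⊎ (to c) (from₁ c) (from₂ c) (disjoint c)) (configs a t))
    where
    to : ∀ c → T (isMergeable k m c) → T (isForest (2 + k) m c) ⊎ T (isMergeable (k + ℓ) m c)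
    to c t with Equivalence.to (T-∧ {good m (faces c)}) t
    ... | g , r with mergeable⁻ k (chain c) r
    ...   | zero  , eq = inj₁ (Equivalence.from T-∧ (g , ≡⇒≡ᵇ _ _ (trans eq (+-identityʳ _))))
    ...   | suc d , eq = inj₂ (Equivalence.from T-∧ (g , mergeable⁺ (k + ℓ) (chain c) d (trans eq (lemma k d ℓ))))
      where
      lemma : ∀ k d ℓ → 2 + k + suc d * ℓ ≡ 2 + (k + ℓ) + d * ℓ
      lemma = solve-∀
    from₁ : ∀ c → T (isForest (2 + k) m c) → T (isMergeable k m c)
    from₁ c t with Equivalence.to (T-∧ {good m (faces c)}) t
    ... | g , r = Equivalence.from T-∧ (g , mergeable⁺ k (chain c) 0 (trans (≡ᵇ⇒≡ _ _ r) (sym (+-identityʳ _))))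
    from₂ : ∀ c → T (isMergeable (k + ℓ) m c) → T (isMergeable k m c)
    from₂ c t with Equivalence.to (T-∧ {good m (faces c)}) t
    ... | g , r with mergeable⁻ (k + ℓ) (chain c) r
    ...   | d , eq = Equivalence.from T-∧ (g , mergeable⁺ k (chain c) (suc d) (trans eq (lemma k d ℓ)))
      where
      lemma : ∀ k d ℓ → 2 + (k + ℓ) + d * ℓ ≡ 2 + k + suc d * ℓ
      lemma = solve-∀
    disjoint : ∀ c → T (isForest (2 + k) m c) → T (isMergeable (k + ℓ) m c) → ⊥
    disjoint c t u with Equivalence.to (T-∧ {good m (faces c)}) t | Equivalence.to (T-∧ {good m (faces c)}) u
    ... | _ , r | _ , r′ with mergeable⁻ (k + ℓ) (chain c) r′
    ...   | d , eq = <-irrefl (trans (sym (≡ᵇ⇒≡ (length (chain c)) (2 + k) r)) eq)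
      (<-≤-trans (+-monoʳ-< 2 (m<m+n k 0<ℓ)) (m≤m+n (2 + (k + ℓ)) (d * ℓ)))

  H-vanish : ∀ a t k m → t < 2 + k + m → H a t k m ≡ 0
  H-vanish a t k m t< = count-0 (All.map none (inv-configs a t))
    where
    none : ∀ {c} → Inv (a + t) a c → ¬ T (isMergeable k m c)
    none {c} inv u with Equivalence.to (T-∧ {good m (faces c)}) u
    ... | g , r with mergeable⁻ k (chain c) r | good-balance {c = c} inv g
    ...   | d , eq | q , eq′ = <-irrefl refl (<-≤-trans t< (begin
      2 + k + m                        ≤⟨ +-mono-≤ (m≤m+n (2 + k) (d * ℓ)) (m≤m+n m (q * ℓ)) ⟩
      2 + k + d * ℓ + (m + q * ℓ)      ≡⟨ cong (_+ (m + q * ℓ)) eq ⟨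
      length (chain c) + (m + q * ℓ)   ≡⟨ eq′ ⟨
      t                                ∎))
      where open ≤-Reasoning

  F-bare : ∀ a t k → F a (suc t) (suc k) 0 ≡ F (suc a) t k 0
  F-bare a t k = trans (go t) (count-map (isForest (suc k) 0) (leaf (suc a)) (configs (suc a) t))
    where
    cs = map (leaf (suc a)) (configs (suc a) t)
    go : ∀ j → count (isForest (suc k) 0) (blockConfigs a j cs) ≡ count (isForest (suc k) 0) cs
    go zero    = refl
    go (suc j) = begin
      count (isForest (suc k) 0) (mapMaybe (merge a b) bl ++ bl)
        ≡⟨ count-++ (isForest (suc k) 0) (mapMaybe (merge a b) bl) bl ⟩
      count (isForest (suc k) 0) (mapMaybe (merge a b) bl) + count (isForest (suc k) 0) bl
        ≡⟨ cong₂ _+_ (trans (count-mapMaybe (isForest (suc k) 0) (merge a b) bl) (count-0 (All.universal none bl))) (go j) ⟩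
      count (isForest (suc k) 0) cs ∎
      where
      open ≡-Reasoning
      b = suc (suc (a + j))
      bl = blockConfigs a j cs
      none : ∀ c → ¬ T (maybe′ (isForest (suc k) 0) false (merge a b c))
      none c u with merge a b c | mergeView a b c
      none c () | _ | unmerged _
      none c () | _ | merged _ _

  -- above b ≤ k says that the chain vertex with exactly k vertices to its right is at most b. This
  -- is the vertex to which a must be joined so that k + 1 chain edges remain.
  isPending : ℕ → ℕ → ℕ → Config → Bool
  isPending k m b c = isMergeable k m c ∧ (above b (chain c) ≤ᵇ k)

  -- Nothing changes if b is off the chain. If b is on it, a mergeable configuration becomes pending
  -- exactly when k vertices remain to the right of b, which is when merging at b leaves a chain of
  -- length k + 1.
  pending-step : ∀ {M a j} k m {c} → Inv M a c × Fresh a (suc (suc (a + j))) c →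
    indicator (isPending k m (suc (suc (a + j))) c) ≡
      indicator (isPending k m (suc (a + j)) c) +
      indicator (maybe′ (isForest (suc k) (suc m)) false (merge a (suc (suc (a + j))) c))
  pending-step {M} {a} {j} k m {c} (inv , fresh)
    with merge a (suc (suc (a + j))) c | mergeView a (suc (suc (a + j))) c
  ... | _ | unmerged {s = s} b∉ =
    trans (cong (λ z → indicator (isMergeable k m c ∧ (z ≤ᵇ k))) (above-∉ (suc (a + j)) b∉)) (sym (+-identityʳ _))
  ... | _ | merged {D} {Ks} pre post = indicator-⊎ to from₁ from₂ disjoint
    where
    b = suc (suc (a + j))
    s = pre ++ b ∷ post
    S = a ∷ pre ++ b ∷ []
    module X = Merge (s≤s (s≤s (m≤m+n a j))) inv fresh
    heights : above (suc (a + j)) s ≡ suc (length post) × above b s ≡ length post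
    heights = above-sorted (suc (a + j)) pre (AllPairs.tail (Inv.sorted inv))
    size : length post ≡ k → suc (length s ∸ k) ≡ length S
    size refl = begin
      suc (length s ∸ length post)                          ≡⟨ cong (λ z → suc (z ∸ length post))
                                                                     (trans (length-++ pre) (+-suc (length pre) (length post))) ⟩
      suc (suc (length pre) + length post ∸ length post)    ≡⟨ cong suc (m+n∸n≡m (suc (length pre)) (length post)) ⟩
      2 + length pre                                        ≡⟨ X.length-new ⟨
      length S                                              ∎
      where open ≡-Reasoning
    to : T (isPending k m b (config D s Ks)) →
         T (isPending k m (suc (a + j)) (config D s Ks)) ⊎
         T (isForest (suc k) (suc m) (config ((a , b) ∷ D) (b ∷ post) (S ∷ Ks)))
    to t with Equivalence.to (T-∧ {isMergeable k m (config D s Ks)}) t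
    ... | t₁ , t₂ with m≤n⇒m<n∨m≡n (subst (_≤ k) (proj₂ heights) (≤ᵇ⇒≤ _ _ t₂))
    ...   | inj₁ lt = inj₁ (Equivalence.from T-∧ (t₁ , ≤⇒≤ᵇ (subst (_≤ k) (sym (proj₁ heights)) lt)))
    ...   | inj₂ eq with Equivalence.to (T-∧ {good m Ks}) t₁
    ...     | g , r with Equivalence.to (T-∧ {length Ks ≡ᵇ m}) g
    ...       | g₁ , g₂ = inj₂ (Equivalence.from T-∧
                ( Equivalence.from T-∧ (g₁ , Equivalence.from (T-∧ {periodic (length S)}) (subst (T ∘ periodic) (size eq) r , g₂))
                , ≡⇒≡ᵇ _ _ eq))
    from₁ : T (isPending k m (suc (a + j)) (config D s Ks)) → T (isPending k m b (config D s Ks))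
    from₁ t with Equivalence.to (T-∧ {isMergeable k m (config D s Ks)}) t
    ... | t₁ , t₂ = Equivalence.from T-∧ (t₁ , ≤⇒≤ᵇ (subst (_≤ k) (sym (proj₂ heights))
      (<⇒≤ (subst (_≤ k) (proj₁ heights) (≤ᵇ⇒≤ _ _ t₂)))))
    from₂ : T (isForest (suc k) (suc m) (config ((a , b) ∷ D) (b ∷ post) (S ∷ Ks))) → T (isPending k m b (config D s Ks))
    from₂ t with Equivalence.to (T-∧ {good (suc m) (S ∷ Ks)}) t
    ... | g , r with Equivalence.to (T-∧ {length Ks ≡ᵇ m}) g | ≡ᵇ⇒≡ (length post) k r
    ...   | g₁ , g₂ | eq with Equivalence.to (T-∧ {periodic (length S)}) g₂
    ...     | pS , pKs = Equivalence.from T-∧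
      ( Equivalence.from (T-∧ {good m Ks}) (Equivalence.from T-∧ (g₁ , pKs) , subst (T ∘ periodic) (sym (size eq)) pS)
      , ≤⇒≤ᵇ (≤-reflexive (trans (proj₂ heights) eq)))
    disjoint : T (isPending k m (suc (a + j)) (config D s Ks)) →
      T (isForest (suc k) (suc m) (config ((a , b) ∷ D) (b ∷ post) (S ∷ Ks))) → ⊥
    disjoint t u = <-irrefl (≡ᵇ⇒≡ (length post) k (proj₂ (Equivalence.to (T-∧ {good (suc m) (S ∷ Ks)}) u)))
      (subst (_≤ k) (proj₁ heights) (≤ᵇ⇒≤ _ _ (proj₂ (Equivalence.to (T-∧ {isMergeable k m (config D s Ks)}) t))))

  -- A mergeable chain has at least k + 2 vertices, so more than k lie beyond its first vertex. This
  -- applies at the start of a block and to the outcome of a merge at b.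
  pending-none : ∀ {M a b} k m {D s Ks} → Inv M a (config D (b ∷ s) Ks) → ¬ T (isPending k m b (config D (b ∷ s) Ks))
  pending-none {b = b} k m {D} {s} {Ks} inv t with Equivalence.to (T-∧ {isMergeable k m (config D (b ∷ s) Ks)}) t
  ... | t₁ , t₂ with Equivalence.to (T-∧ {good m Ks}) t₁
  ...   | _ , r with mergeable⁻ k (b ∷ s) r
  ...     | d , eq = <-irrefl refl (<-≤-trans
    (≤-trans (m≤m+n (suc k) (d * ℓ)) (≤-reflexive (sym (suc-injective eq))))
    (subst (_≤ k) height (≤ᵇ⇒≤ _ _ t₂)))
    where
    height : above b (b ∷ s) ≡ length s
    height = cong₂ _+_ (indicator-0 {b <ᵇ b} (<-irrefl refl ∘ <ᵇ⇒< b b))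
      (count-all (All.map <⇒<ᵇ (AllPairs.head (AllPairs.tail (Inv.sorted inv)))))

  -- Loop invariant of a block: besides the starting configurations, the forests found so far match
  -- the pending configurations, since the one merge that each of these calls for has been made.
  block-step : ∀ {M a cs} k m → All (Inv M (suc a)) cs → ∀ j →
    let bl = blockConfigs a j (map (leaf (suc a)) cs) in
    count (isForest (suc k) (suc m)) bl ≡
      count (isForest (suc k) (suc m)) (map (leaf (suc a)) cs) + count (isPending k m (suc (a + j))) bl
  block-step {M} {a} {cs} k m invs zero = sym (trans
    (cong (count p (map (leaf (suc a)) cs) +_) (count-0 (map⁺ (All.map none invs)))) (+-identityʳ _))
    where
    p = isForest (suc k) (suc m)
    none : ∀ {c} → Inv M (suc a) c → ¬ T (isPending k m (suc (a + 0)) (leaf (suc a) c))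
    none {c} inv = subst (λ z → ¬ T (isPending k m z (leaf (suc a) c))) (cong suc (sym (+-identityʳ a)))
      (pending-none k m (inv-leaf inv))
  block-step {M} {a} {cs} k m invs (suc j) = begin
    count p (mapMaybe (merge a b) bl ++ bl)
      ≡⟨ count-++ p (mapMaybe (merge a b) bl) bl ⟩
    count p (mapMaybe (merge a b) bl) + count p bl
      ≡⟨ cong₂ _+_ (count-mapMaybe p (merge a b) bl) (block-step k m invs j) ⟩
    count (maybe′ p false ∘ merge a b) bl + (count p ls + count (isPending k m (suc (a + j))) bl)
      ≡⟨ lemma (count (maybe′ p false ∘ merge a b) bl) (count p ls) (count (isPending k m (suc (a + j))) bl) ⟩
    count p ls + (0 + (count (isPending k m (suc (a + j))) bl + count (maybe′ p false ∘ merge a b) bl))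
      ≡⟨ cong (λ z → count p ls + (0 + z)) (count-+ {p = isPending k m b} (All.map (pending-step k m) inv)) ⟨
    count p ls + (0 + count (isPending k m b) bl)
      ≡⟨ cong (λ z → count p ls + (z + count (isPending k m b) bl))
           (trans (count-mapMaybe (isPending k m b) (merge a b) bl) (count-0 (All.map none inv))) ⟨
    count p ls + (count (isPending k m b) (mapMaybe (merge a b) bl) + count (isPending k m b) bl)
      ≡⟨ cong (count p ls +_) (count-++ (isPending k m b) (mapMaybe (merge a b) bl) bl) ⟨
    count p ls + count (isPending k m b) (mapMaybe (merge a b) bl ++ bl)
      ≡⟨ cong (λ z → count p ls + count (isPending k m (suc z)) (mapMaybe (merge a b) bl ++ bl)) (+-suc a j) ⟨
    count p ls + count (isPending k m (suc (a + suc j))) (mapMaybe (merge a b) bl ++ bl) ∎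
    where
    open ≡-Reasoning
    p = isForest (suc k) (suc m)
    b = suc (suc (a + j))
    ls = map (leaf (suc a)) cs
    bl = blockConfigs a j ls
    inv : All (λ c → Inv M a c × Fresh a b c) bl
    inv = inv-block j invs
    none : ∀ {c} → Inv M a c × Fresh a b c → ¬ T (maybe′ (isPending k m b) false (merge a b c))
    none {c} (i , fresh) t with merge a b c | mergeView a b c
    none (i , fresh) t | _ | merged pre post =
      pending-none k m (Merge.inv-merge (s≤s (s≤s (m≤m+n a j))) i fresh) t
    lemma : ∀ x y z → x + (y + z) ≡ y + (0 + (z + x))
    lemma = solve-∀

  -- At the end of the block the threshold is the last polygon vertex. No chain vertex exceeds it,
  -- so every mergeable configuration is pending.
  F-step : ∀ a t k m → F a (suc t) (suc k) (suc m) ≡ F (suc a) t k (suc m) + H a (suc t) k m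
  F-step a t k m = trans (block-step k m invs t)
    (cong₂ _+_ (count-map (isForest (suc k) (suc m)) (leaf (suc a)) (configs (suc a) t))
      (count-cong (All.map full (inv-block t invs))))
    where
    invs : All (Inv (suc a + t) (suc a)) (configs (suc a) t)
    invs = inv-configs (suc a) t
    full : ∀ {c} → Inv (suc a + t) a c × Fresh a (suc (suc (a + t))) c → isPending k m (suc (a + t)) c ≡ isMergeable k m c
    full {c} (i , _) = T-ext (λ t → proj₁ (Equivalence.to T-∧ t))
      (λ t → Equivalence.from T-∧ (t , ≤⇒≤ᵇ (subst (_≤ k) (sym zero-above) z≤n)))
      where
      zero-above : above (suc (a + t)) (chain c) ≡ 0
      zero-above = count-0 (All.tabulate (λ {v} v∈ u → <-irrefl refl
        (<-≤-trans (<ᵇ⇒< _ _ u) (subst (v ≤_) (Inv.last i) (≤-lastOf (Inv.sorted i) (there v∈))))))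

  open ForestNumbers ℓ 0<ℓ F H F-empty F-rootless F-bare F-step H-step H-vanish public using (F-tree)

-- Comparison with dissections

unique-↭ : {xs ys : List A} → Unique xs → Unique ys →
  (∀ {x} → x ∈ xs → x ∈ ys) → (∀ {x} → x ∈ ys → x ∈ xs) → xs ↭ ys
unique-↭ u v f g = ∼bag⇒↭ (unique∧set⇒bag u v (mk⇔ f g))

T-not : ∀ {b} → T (not b) → ¬ T b
T-not {false} _ ()

not-T : ∀ {b} → ¬ T b → T (not b)
not-T {false} _  = _
not-T {true}  ¬t = ¬t _

all-↭ : ∀ (p : A → Bool) {xs ys} → xs ↭ ys → all p xs ≡ all p ys
all-↭ p {xs} {ys} σ = T-ext (all⁻ p ∘ All-resp-↭ σ ∘ all⁺ p xs) (all⁻ p ∘ All-resp-↭ (↭-sym σ) ∘ all⁺ p ys)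

all-cong : ∀ {p q : A → Bool} → (∀ x → p x ≡ q x) → ∀ xs → all p xs ≡ all q xs
all-cong eq []       = refl
all-cong eq (x ∷ xs) = cong₂ _∧_ (eq x) (all-cong eq xs)

filterᵇ-cong : ∀ {p q : A → Bool} → (∀ x → p x ≡ q x) → ∀ xs → filterᵇ p xs ≡ filterᵇ q xs
filterᵇ-cong eq [] = refl
filterᵇ-cong {p = p} {q} eq (x ∷ xs) with p x | q x | eq x
... | true  | .true  | refl = cong (x ∷_) (filterᵇ-cong eq xs)
... | false | .false | refl = filterᵇ-cong eq xs

-- Subsets of non-crossing sets are non-crossing; hence the sets that fail before an edge is added
-- can be discarded first, and the recursion runs on the surviving ones.
filterᵇ-map : ∀ (p : A → Bool) (f : A → A) → (∀ x → T (p (f x)) → T (p x)) →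
  ∀ xs → filterᵇ p (map f xs) ≡ map f (filterᵇ (p ∘ f) (filterᵇ p xs))
filterᵇ-map p f h [] = refl
filterᵇ-map p f h (x ∷ xs) with p (f x) in eq′ | p x in eq
... | true  | false = ⊥-elim (subst T eq (h x (subst T (sym eq′) _)))
... | false | false = filterᵇ-map p f h xs
... | true  | true  rewrite eq′ = cong (f x ∷_) (filterᵇ-map p f h xs)
... | false | true  rewrite eq′ = filterᵇ-map p f h xs

count-∧ : ∀ (p q : A → Bool) xs → count (λ x → p x ∧ q x) xs ≡ count q (filterᵇ p xs)
count-∧ p q [] = refl
count-∧ p q (x ∷ xs) with p x
... | true  = cong (indicator (q x) +_) (count-∧ p q xs)
... | false = count-∧ p q xs

count-sublists-∷ : ∀ (p : List A → Bool) x xs →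
  count p (sublists (x ∷ xs)) ≡ count (p ∘ (x ∷_)) (sublists xs) + count p (sublists xs)
count-sublists-∷ p x xs = trans (count-++ p (map (x ∷_) (sublists xs)) (sublists xs))
  (cong (_+ count p (sublists xs)) (count-map p (x ∷_) (sublists xs)))

-- This permits the diagonals to be listed in the order of construction instead of the order in
-- `diagonals`.
count-sublists-↭ : ∀ {xs ys : List A} → xs ↭ ys → (p : List A → Bool) →
  (∀ {D D′} → D ↭ D′ → p D ≡ p D′) → count p (sublists xs) ≡ count p (sublists ys)
count-sublists-↭ ↭.refl p resp = refl
count-sublists-↭ (↭.trans σ τ) p resp = trans (count-sublists-↭ σ p resp) (count-sublists-↭ τ p resp)
count-sublists-↭ {xs = _ ∷ xs} {_ ∷ ys} (↭.prep x σ) p resp = begin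
  count p (sublists (x ∷ xs))                                   ≡⟨ count-sublists-∷ p x xs ⟩
  count (p ∘ (x ∷_)) (sublists xs) + count p (sublists xs)
    ≡⟨ cong₂ _+_ (count-sublists-↭ σ (p ∘ (x ∷_)) (resp ∘ ↭.prep x)) (count-sublists-↭ σ p resp) ⟩
  count (p ∘ (x ∷_)) (sublists ys) + count p (sublists ys)      ≡⟨ count-sublists-∷ p x ys ⟨
  count p (sublists (x ∷ ys))                                   ∎
  where open ≡-Reasoning
-- The sublists fall into four classes according to which of x and y they contain; the swap
-- exchanges the two mixed classes.
count-sublists-↭ {xs = _ ∷ _ ∷ xs} {_ ∷ _ ∷ ys} (↭.swap x y σ) p resp = begin
  count p (sublists (x ∷ y ∷ xs))
    ≡⟨ expand p x y xs ⟩
  N (p ∘ (x ∷_) ∘ (y ∷_)) xs + N (p ∘ (x ∷_)) xs + (N (p ∘ (y ∷_)) xs + N p xs)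
    ≡⟨ cong₂ _+_ (cong₂ _+_
         (trans (count-cong (All.universal (λ D → resp (↭.swap x y ↭.refl)) (sublists xs)))
           (ih (p ∘ (y ∷_) ∘ (x ∷_)) (resp ∘ ↭.prep y ∘ ↭.prep x)))
         (ih (p ∘ (x ∷_)) (resp ∘ ↭.prep x))) (cong₂ _+_ (ih (p ∘ (y ∷_)) (resp ∘ ↭.prep y)) (ih p resp)) ⟩
  N (p ∘ (y ∷_) ∘ (x ∷_)) ys + N (p ∘ (x ∷_)) ys + (N (p ∘ (y ∷_)) ys + N p ys)
    ≡⟨ +-interchange (N (p ∘ (y ∷_) ∘ (x ∷_)) ys) (N (p ∘ (x ∷_)) ys) (N (p ∘ (y ∷_)) ys) (N p ys) ⟩
  N (p ∘ (y ∷_) ∘ (x ∷_)) ys + N (p ∘ (y ∷_)) ys + (N (p ∘ (x ∷_)) ys + N p ys)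
    ≡⟨ expand p y x ys ⟨
  count p (sublists (y ∷ x ∷ ys)) ∎
  where
  open ≡-Reasoning
  N : (List _ → Bool) → List _ → ℕ
  N q zs = count q (sublists zs)
  ih : ∀ q → (∀ {D D′} → D ↭ D′ → q D ≡ q D′) → N q xs ≡ N q ys
  ih = count-sublists-↭ σ
  expand : ∀ q u v zs → N q (u ∷ v ∷ zs) ≡ N (q ∘ (u ∷_) ∘ (v ∷_)) zs + N (q ∘ (u ∷_)) zs + (N (q ∘ (v ∷_)) zs + N q zs)
  expand q u v zs = trans (count-sublists-∷ q u (v ∷ zs))
    (cong₂ _+_ (count-sublists-∷ (q ∘ (u ∷_)) v zs) (count-sublists-∷ q v zs))

∈-sublists⇒⊆ : ∀ {xs S : List A} → S ∈ sublists xs → ∀ {v} → v ∈ S → v ∈ xs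
∈-sublists⇒⊆ {xs = []}     (here refl) ()
∈-sublists⇒⊆ {xs = x ∷ xs} S∈ v∈ with ∈-++⁻ (map (x ∷_) (sublists xs)) S∈
... | inj₂ S∈′ = there (∈-sublists⇒⊆ S∈′ v∈)
... | inj₁ S∈map with _ , S∈′ , refl ← ∈-map⁻ (x ∷_) S∈map with v∈
...   | here refl = here refl
...   | there v∈′ = there (∈-sublists⇒⊆ S∈′ v∈′)

∈-sublists⇒sorted : ∀ {xs S} → Sorted xs → S ∈ sublists xs → Sorted S
∈-sublists⇒sorted {[]}     _        (here refl) = []
∈-sublists⇒sorted {x ∷ xs} (p ∷ ps) S∈ with ∈-++⁻ (map (x ∷_) (sublists xs)) S∈
... | inj₂ S∈′ = ∈-sublists⇒sorted ps S∈′
... | inj₁ S∈map with _ , S∈′ , refl ← ∈-map⁻ (x ∷_) S∈map =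
  All.tabulate (λ v∈ → All.lookup p (∈-sublists⇒⊆ S∈′ v∈)) ∷ ∈-sublists⇒sorted ps S∈′

∈-sublists⁺ : ∀ {xs S} → Sorted xs → Sorted S → (∀ {v} → v ∈ S → v ∈ xs) → S ∈ sublists xs
∈-sublists⁺ {[]} {[]}    _ _ _ = here refl
∈-sublists⁺ {[]} {_ ∷ _} _ _ S⊆ with () ← S⊆ (here refl)
∈-sublists⁺ {x ∷ xs} {[]} (_ ∷ ps) _ _ = ∈-++⁺ʳ (map (x ∷_) (sublists xs)) (∈-sublists⁺ ps [] λ ())
∈-sublists⁺ {x ∷ xs} {y ∷ ys} (p ∷ ps) (q ∷ qs) S⊆ with S⊆ (here refl)
... | here refl = ∈-++⁺ˡ (∈-map⁺ (x ∷_) (∈-sublists⁺ ps qs λ v∈ → ∈-tail (All.lookup q v∈) (S⊆ (there v∈))))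
... | there y∈ = ∈-++⁺ʳ (map (x ∷_) (sublists xs))
  (∈-sublists⁺ ps (q ∷ qs) λ v∈ → ∈-tail (<-≤-trans (All.lookup p y∈) (head-≤ (q ∷ qs) v∈)) (S⊆ v∈))

sublists-unique : ∀ {xs : List A} → Unique xs → Unique (sublists xs)
sublists-unique []       = [] ∷ []
sublists-unique {xs = x ∷ xs} (x∉ ∷ u) = Unique.++⁺ (Unique.map⁺ ∷-injectiveʳ ih) ih disjoint
  where
  ih : Unique (sublists xs)
  ih = sublists-unique u
  disjoint : ∀ {S} → S ∈ map (x ∷_) (sublists xs) × S ∈ sublists xs → ⊥
  disjoint (S∈map , S∈) with _ , _ , refl ← ∈-map⁻ (x ∷_) S∈map =
    All.lookup x∉ (∈-sublists⇒⊆ S∈ (here refl)) refl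

upTo-sorted : ∀ n → Sorted (upTo n)
upTo-sorted n = AllPairs.applyUpTo⁺₁ id n (λ i<j _ → i<j)

-- Boolean tests on edges, and non-crossing edge sets as configurations

memEdge⁺ : ∀ {e D} → e ∈ D → T (memEdge e D)
memEdge⁺ {a , b} {D} e∈ = any⁺ _ (lose e∈ (Equivalence.from T-∧ (≡⇒≡ᵇ a a refl , ≡⇒≡ᵇ b b refl)))

memEdge⁻ : ∀ {e D} → T (memEdge e D) → e ∈ D
memEdge⁻ {a , b} {D} t with (c , d) , f∈ , eq ← find (any⁻ (eqEdge (a , b)) D t)
  with p , q ← Equivalence.to (T-∧ {a ≡ᵇ c}) eq
  with refl ← ≡ᵇ⇒≡ a c p | refl ← ≡ᵇ⇒≡ b d q = f∈

memEdge-↭ : ∀ e {D D′} → D ↭ D′ → memEdge e D ≡ memEdge e D′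
memEdge-↭ e σ = T-ext (memEdge⁺ ∘ ∈-resp-↭ σ ∘ memEdge⁻ {e}) (memEdge⁺ ∘ ∈-resp-↭ (↭-sym σ) ∘ memEdge⁻ {e})

isSide⁻ : ∀ {M u w} → T (isSide (suc M) (u , w)) → w ≡ suc u ⊎ (u , w) ≡ (0 , M)
isSide⁻ {M} {u} {w} t with Equivalence.to (T-∨ {suc u ≡ᵇ w}) t
... | inj₁ p = inj₁ (sym (≡ᵇ⇒≡ (suc u) w p))
... | inj₂ p with Equivalence.to (T-∧ {u ≡ᵇ 0}) p
...   | q , r = inj₂ (cong₂ _,_ (≡ᵇ⇒≡ u 0 q) (≡ᵇ⇒≡ w M r))

isSide⁺ : ∀ {M u w} → w ≡ suc u ⊎ (u , w) ≡ (0 , M) → T (isSide (suc M) (u , w))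
isSide⁺ {u = u} (inj₁ refl) = Equivalence.from T-∨ (inj₁ (≡⇒≡ᵇ (suc u) (suc u) refl))
isSide⁺ {M} (inj₂ refl) = Equivalence.from (T-∨ {1 ≡ᵇ M}) (inj₂ (≡⇒≡ᵇ M M refl))

crosses⁻ : ∀ {e f} → T (crosses e f) → Crossing e f ⊎ Crossing f e
crosses⁻ {a , b} {c , d} t with Equivalence.to (T-∨ {(a <ᵇ c) ∧ (c <ᵇ b) ∧ (b <ᵇ d)}) t
... | inj₁ p with q , r ← Equivalence.to (T-∧ {a <ᵇ c}) p with r₁ , r₂ ← Equivalence.to (T-∧ {c <ᵇ b}) r
  = inj₁ (<ᵇ⇒< a c q , <ᵇ⇒< c b r₁ , <ᵇ⇒< b d r₂)
... | inj₂ p with q , r ← Equivalence.to (T-∧ {c <ᵇ a}) p with r₁ , r₂ ← Equivalence.to (T-∧ {a <ᵇ d}) r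
  = inj₂ (<ᵇ⇒< c a q , <ᵇ⇒< a d r₁ , <ᵇ⇒< d b r₂)

crosses⁺ : ∀ {e f} → Crossing e f → T (crosses e f)
crosses⁺ (p , q , r) = Equivalence.from T-∨ (inj₁ (Equivalence.from T-∧ (<⇒<ᵇ p , Equivalence.from T-∧ (<⇒<ᵇ q , <⇒<ᵇ r))))

Planar : List Edge → Set
Planar D = ∀ {e f} → e ∈ D → f ∈ D → ¬ Crossing e f

nonCrossing⁺ : ∀ {D} → Planar D → T (pairwiseNonCrossing D)
nonCrossing⁺ planar = all⁻ _ (All.tabulate λ {e} e∈ → all⁻ _ (All.tabulate λ {f} f∈ →
  not-T ([ planar e∈ f∈ , planar f∈ e∈ ]′ ∘ crosses⁻ {e} {f})))

nonCrossing⁻ : ∀ {D} → T (pairwiseNonCrossing D) → Planar D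
nonCrossing⁻ {D} t {e} e∈ f∈ x = T-not (All.lookup (all⁺ _ D (All.lookup (all⁺ _ D t) e∈)) f∈) (crosses⁺ x)

-- The edge decided last stands first, because `sublists` treats the tail before the head.
blockEdges : ℕ → ℕ → List Edge → List Edge
blockEdges a zero    E = E
blockEdges a (suc j) E = (a , suc (suc (a + j))) ∷ blockEdges a j E

edgesFrom : ℕ → ℕ → List Edge
edgesFrom a zero    = []
edgesFrom a (suc t) = blockEdges a t (edgesFrom (suc a) t)

-- A vertex off the chain lies under an edge (u , w). If a < u, this edge crosses (a , b); if u = a,
-- then b < w contradicts freshness.
uncovered : ∀ {M a b c} → Inv M a c → Fresh a b c → 2 + a ≤ b → b ≤ M → Planar ((a , b) ∷ edges c) → b ∈ chain c
uncovered inv fresh 2+a≤b b≤M planar with Inv.covered inv (<⇒≤ (<⇒≤ 2+a≤b)) b≤M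
... | inj₁ (here refl) = contradiction (<⇒≤ 2+a≤b) (<-irrefl refl)
... | inj₁ (there b∈)  = b∈
... | inj₂ (u , w , e∈ , u<b , b<w) with m≤n⇒m<n∨m≡n (proj₁ (Inv.bounds inv e∈))
...   | inj₁ a<u  = contradiction (a<u , u<b , b<w) (planar (here refl) (there e∈))
...   | inj₂ refl = contradiction (fresh e∈) (<-asym b<w)

merge-edges : ∀ {M a b cs} → 2 + a ≤ b → b ≤ M → All (λ c → Inv M a c × Fresh a b c) cs →
  map ((a , b) ∷_) (filterᵇ (pairwiseNonCrossing ∘ ((a , b) ∷_)) (map edges cs)) ≡ map edges (mapMaybe (merge a b) cs)
merge-edges _ _ [] = refl
merge-edges {a = a} {b} {c ∷ cs} 2+a≤b b≤M ((inv , fresh) ∷ invs)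
  with pairwiseNonCrossing ((a , b) ∷ edges c) in eq | merge a b c | mergeView a b c
... | true  | _ | merged pre post = cong (_ ∷_) (merge-edges 2+a≤b b≤M invs)
... | false | _ | merged pre post = ⊥-elim (subst T eq (nonCrossing⁺ (Inv.planar (Merge.inv-merge 2+a≤b inv fresh))))
... | false | _ | unmerged b∉ = merge-edges 2+a≤b b≤M invs
... | true  | _ | unmerged b∉ = contradiction (uncovered inv fresh 2+a≤b b≤M (nonCrossing⁻ (subst T (sym eq) _))) b∉

block-nonCrossing : ∀ {M a E cs} j → suc (a + j) ≤ M → All (Inv M (suc a)) cs →
  filterᵇ pairwiseNonCrossing (sublists E) ≡ map edges cs →
  filterᵇ pairwiseNonCrossing (sublists (blockEdges a j E)) ≡ map edges (blockConfigs a j (map (leaf (suc a)) cs))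
block-nonCrossing {cs = cs} zero _ _ eq = trans eq (map-∘ cs)
block-nonCrossing {M} {a} {E} {cs} (suc j) bound invs eq = begin
  filterᵇ nc (map (x ∷_) r ++ r)
    ≡⟨ filter-++ (T? ∘ nc) (map (x ∷_) r) r ⟩
  filterᵇ nc (map (x ∷_) r) ++ filterᵇ nc r
    ≡⟨ cong (_++ filterᵇ nc r) (filterᵇ-map nc (x ∷_)
         (λ D t → nonCrossing⁺ {D} (λ e∈ f∈ → nonCrossing⁻ t (there e∈) (there f∈))) r) ⟩
  map (x ∷_) (filterᵇ (nc ∘ (x ∷_)) (filterᵇ nc r)) ++ filterᵇ nc r
    ≡⟨ cong (λ z → map (x ∷_) (filterᵇ (nc ∘ (x ∷_)) z) ++ z) (block-nonCrossing j (<⇒≤ b≤M) invs eq) ⟩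
  map (x ∷_) (filterᵇ (nc ∘ (x ∷_)) (map edges bl)) ++ map edges bl
    ≡⟨ cong (_++ map edges bl) (merge-edges (s≤s (s≤s (m≤m+n a j))) b≤M (inv-block j invs)) ⟩
  map edges (mapMaybe (merge a b) bl) ++ map edges bl
    ≡⟨ map-++ edges (mapMaybe (merge a b) bl) bl ⟨
  map edges (mapMaybe (merge a b) bl ++ bl) ∎
  where
  open ≡-Reasoning
  nc = pairwiseNonCrossing
  b = suc (suc (a + j))
  x = (a , b)
  r = sublists (blockEdges a j E)
  bl = blockConfigs a j (map (leaf (suc a)) cs)
  b≤M : b ≤ M
  b≤M = subst (λ z → suc z ≤ M) (+-suc a j) bound

configs-nonCrossing : ∀ a t → filterᵇ pairwiseNonCrossing (sublists (edgesFrom a t)) ≡ map edges (configs a t)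
configs-nonCrossing a zero    = refl
configs-nonCrossing a (suc t) = block-nonCrossing t ≤-refl (inv-configs (suc a) t) (configs-nonCrossing (suc a) t)

block-∈⁻ : ∀ {a E u w} j → (u , w) ∈ blockEdges a j E → (u ≡ a × 2 + a ≤ w × w ≤ suc (a + j)) ⊎ (u , w) ∈ E
block-∈⁻ zero    e∈ = inj₂ e∈
block-∈⁻ {a} (suc j) (here refl) = inj₁ (refl , s≤s (s≤s (m≤m+n a j)) , s≤s (≤-reflexive (sym (+-suc a j))))
block-∈⁻ {a} (suc j) (there e∈) with block-∈⁻ j e∈
... | inj₁ (p , q , r) = inj₁ (p , q , ≤-trans r (s≤s (+-monoʳ-≤ a (n≤1+n j))))
... | inj₂ e∈E         = inj₂ e∈E

block-∈⁺ˡ : ∀ {a E w} j → 2 + a ≤ w → w ≤ suc (a + j) → (a , w) ∈ blockEdges a j E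
block-∈⁺ˡ {a} {w = w} zero p q = contradiction (≤-trans p (subst (λ z → w ≤ suc z) (+-identityʳ a) q)) (<-irrefl refl)
block-∈⁺ˡ {a} {w = w} (suc j) p q with m≤n⇒m<n∨m≡n (subst (λ z → w ≤ suc z) (+-suc a j) q)
... | inj₁ (s≤s q′) = there (block-∈⁺ˡ j p q′)
... | inj₂ refl     = here refl

block-∈⁺ʳ : ∀ {a E e} j → e ∈ E → e ∈ blockEdges a j E
block-∈⁺ʳ zero    e∈ = e∈
block-∈⁺ʳ (suc j) e∈ = there (block-∈⁺ʳ j e∈)

block-unique : ∀ {a E} j → (∀ {w} → (a , w) ∉ E) → Unique E → Unique (blockEdges a j E)
block-unique zero    _ u = u
block-unique {a} {E} (suc j) a∉ u = ¬Any⇒All¬ (blockEdges a j E) new ∷ block-unique j a∉ u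
  where
  new : (a , suc (suc (a + j))) ∉ blockEdges a j E
  new e∈ with block-∈⁻ j e∈
  ... | inj₁ (_ , _ , r) = <-irrefl refl r
  ... | inj₂ e∈E         = a∉ e∈E

edgesFrom-∈⁻ : ∀ {a u w} t → (u , w) ∈ edgesFrom a t → a ≤ u × 2 + u ≤ w × w ≤ a + t
edgesFrom-∈⁻ {a} (suc t) e∈ with block-∈⁻ t e∈
... | inj₁ (refl , q , r) = ≤-refl , q , ≤-trans r (≤-reflexive (sym (+-suc a t)))
... | inj₂ e∈′ with edgesFrom-∈⁻ t e∈′
...   | p , q , r = <⇒≤ p , q , ≤-trans r (≤-reflexive (sym (+-suc a t)))

edgesFrom-∈⁺ : ∀ {a u w} t → a ≤ u → 2 + u ≤ w → w ≤ a + t → (u , w) ∈ edgesFrom a t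
edgesFrom-∈⁺ {a} {u} {w} zero p q r =
  contradiction (≤-trans (≤-trans (n≤1+n _) q) (≤-trans (subst (w ≤_) (+-identityʳ a) r) p)) (<-irrefl refl)
edgesFrom-∈⁺ {a} (suc t) p q r with m≤n⇒m<n∨m≡n p | ≤-trans r (≤-reflexive (+-suc a t))
... | inj₂ refl | r′ = block-∈⁺ˡ t q r′
... | inj₁ a<u  | r′ = block-∈⁺ʳ t (edgesFrom-∈⁺ t a<u q r′)

edgesFrom-unique : ∀ a t → Unique (edgesFrom a t)
edgesFrom-unique a zero    = []
edgesFrom-unique a (suc t) = block-unique t (λ e∈ → <-irrefl refl (proj₁ (edgesFrom-∈⁻ t e∈))) (edgesFrom-unique (suc a) t)

allPairs : ℕ → List Edge
allPairs N = concatMap (λ b → map (λ a → (a , b)) (upTo b)) (upTo N)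

allPairs-unique : ∀ N → Unique (allPairs N)
allPairs-unique N = Unique.concat⁺
  (map⁺ (All.universal (λ b → Unique.map⁺ (λ { refl → refl }) (Unique.upTo⁺ b)) (upTo N)))
  (AllPairs.map⁺ (AllPairs.applyUpTo⁺₁ id N (λ {i} {j} i<j _ → disjoint i<j)))
  where
  disjoint : ∀ {i j} → i < j → ∀ {e} → e ∈ map (λ a → (a , i)) (upTo i) × e ∈ map (λ a → (a , j)) (upTo j) → ⊥
  disjoint i<j (p , q) with _ , _ , refl ← ∈-map⁻ _ p | _ , _ , refl ← ∈-map⁻ _ q = <-irrefl refl i<j

allPairs-∈⁺ : ∀ {N a b} → a < b → b < N → (a , b) ∈ allPairs N
allPairs-∈⁺ a<b b<N = ∈-concatMap⁺ _ (lose (∈-upTo⁺ b<N) (∈-map⁺ _ (∈-upTo⁺ a<b)))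

allPairs-∈⁻ : ∀ {N a b} → (a , b) ∈ allPairs N → a < b × b < N
allPairs-∈⁻ {N} e∈ with _ , b∈ , e∈′ ← find (∈-concatMap⁻ (λ b → map (λ a → (a , b)) (upTo b)) {upTo N} e∈)
  with _ , a∈ , refl ← ∈-map⁻ _ e∈′ = ∈-upTo⁻ a∈ , ∈-upTo⁻ b∈

-- The block of 0 stops at (0 , j + 1), one edge short of a full block, because (0 , j + 2) is the
-- root side and not a diagonal.
diagonals-↭ : ∀ j → diagonals (3 + j) ↭ blockEdges 0 j (edgesFrom 1 (suc j))
diagonals-↭ j = unique-↭
  (Unique.filter⁺ (T? ∘ λ e → not (isSide (3 + j) e)) (allPairs-unique (3 + j)))
  (block-unique j (λ e∈ → contradiction (proj₁ (edgesFrom-∈⁻ (suc j) e∈)) λ ()) (edgesFrom-unique 1 (suc j)))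
  to from
  where
  to : ∀ {e} → e ∈ diagonals (3 + j) → e ∈ blockEdges 0 j (edgesFrom 1 (suc j))
  to {a , b} e∈ with e∈′ , ns ← ∈-filter⁻ (T? ∘ λ e → not (isSide (3 + j) e)) {xs = allPairs (3 + j)} e∈
    with allPairs-∈⁻ {3 + j} e∈′
  ... | a<b , s≤s b≤M with m≤n⇒m<n∨m≡n a<b
  ...   | inj₂ eq = contradiction (isSide⁺ (inj₁ (sym eq))) (T-not ns)
  to {suc a , b} e∈ | a<b , s≤s b≤M | inj₁ q = block-∈⁺ʳ j (edgesFrom-∈⁺ (suc j) (s≤s z≤n) q b≤M)
  to {zero  , b} e∈ | a<b , s≤s b≤M | inj₁ q with m≤n⇒m<n∨m≡n b≤M
  ... | inj₁ (s≤s b<M) = block-∈⁺ˡ j q b<M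
  ... | inj₂ refl = contradiction (isSide⁺ {2 + j} (inj₂ refl)) (T-not ns)
  from : ∀ {e} → e ∈ blockEdges 0 j (edgesFrom 1 (suc j)) → e ∈ diagonals (3 + j)
  from {a , b} e∈ = ∈-filter⁺ (T? ∘ λ e → not (isSide (3 + j) e)) (allPairs-∈⁺ (<⇒≤ (proj₁ b-range)) (proj₁ (proj₂ b-range)))
    (not-T ([ (λ { refl → <-irrefl refl (proj₁ b-range) }) , proj₂ (proj₂ b-range) ]′ ∘ isSide⁻ {2 + j}))
    where
    b-range : 2 + a ≤ b × b < 3 + j × (a , b) ≢ (0 , 2 + j)
    b-range with block-∈⁻ j e∈
    ... | inj₁ (refl , q , r) = q , s≤s (≤-trans r (n≤1+n _)) , λ { refl → <-irrefl refl r }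
    ... | inj₂ e∈′ with edgesFrom-∈⁻ (suc j) e∈′
    ...   | p , q , r = q , s≤s r , λ { refl → contradiction p λ () }

-- The Boolean cell test and the cells of a dissection

cyclicPairs⁻ : ∀ S {e} → e ∈ cyclicPairs S → e ∈ adjacentPairs S ⊎ e ≡ top S
cyclicPairs⁻ (x ∷ xs) e∈ with ∈-++⁻ (adjacentPairs (x ∷ xs)) e∈
... | inj₁ adj         = inj₁ adj
... | inj₂ (here refl) = inj₂ refl

cyclicPairs⁺ˡ : ∀ S {e} → e ∈ adjacentPairs S → e ∈ cyclicPairs S
cyclicPairs⁺ˡ (x ∷ xs) = ∈-++⁺ˡ

cyclicPairs⁺ʳ : ∀ {S n} → suc n ≤ length S → top S ∈ cyclicPairs S
cyclicPairs⁺ʳ {x ∷ xs} _ = ∈-++⁺ʳ (adjacentPairs (x ∷ xs)) (here refl)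

top-∈ : ∀ {S n} → suc n ≤ length S → proj₁ (top S) ∈ S × proj₂ (top S) ∈ S
top-∈ {x ∷ xs} _ = here refl , lastOf-∈ x xs

cellTest : ℕ → List Edge → List ℕ → Edge → Bool
cellTest N D S e = if memEdge e (cyclicPairs S) then (isSide N e ∨ memEdge e D) else not (memEdge e D)

cellTest-cyclic : ∀ {N D S e} → e ∈ cyclicPairs S → T (cellTest N D S e) → T (isSide N e) ⊎ e ∈ D
cellTest-cyclic {N} {D} {S} {e} e∈ t with memEdge e (cyclicPairs S) | memEdge⁺ e∈
... | true | _ with Equivalence.to (T-∨ {isSide N e}) t
...   | inj₁ side = inj₁ side
...   | inj₂ mem  = inj₂ (memEdge⁻ mem)

cellTest-chord : ∀ {N D S e} → T (cellTest N D S e) → e ∈ D → e ∈ cyclicPairs S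
cellTest-chord {N} {D} {S} {e} t e∈ with memEdge e (cyclicPairs S) in eq
... | true  = memEdge⁻ (subst T (sym eq) _)
... | false = contradiction (memEdge⁺ e∈) (T-not t)

cellTest⁺ : ∀ {N D S e} → (e ∈ cyclicPairs S → T (isSide N e) ⊎ e ∈ D) → (e ∈ D → e ∈ cyclicPairs S) → T (cellTest N D S e)
cellTest⁺ {N} {D} {S} {e} f g with memEdge e (cyclicPairs S) in eq
... | false = not-T (λ m → subst T eq (memEdge⁺ (g (memEdge⁻ m))))
... | true with f (memEdge⁻ (subst T (sym eq) _))
...   | inj₁ side = Equivalence.from T-∨ (inj₁ side)
...   | inj₂ e∈   = Equivalence.from (T-∨ {isSide N e}) (inj₂ (memEdge⁺ e∈))

-- The root edge (0 , M) is a side for `isSide` but a member of the edge set for `Cell`. As an edge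
-- it can join two vertices of S only if they are the extremes of S, so it never cuts a cell.
isCell⁻ : ∀ {M D S} → Sorted S → (∀ {v} → v ∈ S → v ≤ M) → T (isCell (suc M) D S) → Cell ((0 , M) ∷ D) S
isCell⁻ {M} {D} {S} sorted S≤M t = record
  { sorted = sorted
  ; long   = long
  ; closed = closed
  ; sides  = λ e∈ → [ inj₁ , inj₂ ]′ (cyclic (adjacent⊆ordered S e∈) (cyclicPairs⁺ˡ S e∈))
  ; empty  = empty
  }
  where
  long : 3 ≤ length S
  long = ≤-pred (<ᵇ⇒< 3 (suc (length S)) (proj₁ (Equivalence.to (T-∧ {3 <ᵇ suc (length S)}) t)))
  tests : All (T ∘ cellTest (suc M) D S) (orderedPairs S)
  tests = all⁺ (cellTest (suc M) D S) (orderedPairs S) (proj₂ (Equivalence.to (T-∧ {3 <ᵇ suc (length S)}) t))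
  cyclic : ∀ {u w} → (u , w) ∈ orderedPairs S → (u , w) ∈ cyclicPairs S → w ≡ suc u ⊎ (u , w) ∈ (0 , M) ∷ D
  cyclic e∈ e∈c with cellTest-cyclic {suc M} {D} {S} e∈c (All.lookup tests e∈)
  ... | inj₂ e∈D  = inj₂ (there e∈D)
  ... | inj₁ side with isSide⁻ {M} side
  ...   | inj₁ unit = inj₁ unit
  ...   | inj₂ root = inj₂ (here root)
  closed : top S ∈ (0 , M) ∷ D
  closed with v , v∈ , x<v , v<z ← top-wide sorted long
    with cyclic (ordered⁺ sorted (proj₁ (top-∈ long)) (proj₂ (top-∈ long)) (<-trans x<v v<z)) (cyclicPairs⁺ʳ {S} long)
  ... | inj₂ e∈   = e∈
  ... | inj₁ unit = contradiction (<-≤-trans v<z (subst (_≤ v) (sym unit) x<v)) (<-irrefl refl)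
  empty : ∀ {u v w} → (u , w) ∈ (0 , M) ∷ D → u ∈ S → v ∈ S → w ∈ S → u < v → v < w → (u , w) ≡ top S
  empty (here refl) u∈ _ w∈ _ _ = cong₂ _,_
    (sym (n≤0⇒n≡0 (proj₁ (top-≤ sorted u∈))))
    (≤-antisym (proj₂ (top-≤ sorted w∈)) (S≤M (proj₂ (top-∈ long))))
  empty (there e∈) u∈ v∈ w∈ u<v v<w
    with cyclicPairs⁻ S (cellTest-chord {suc M} {D} {S} (All.lookup tests (ordered⁺ sorted u∈ w∈ (<-trans u<v v<w))) e∈)
  ... | inj₁ adj = ⊥-elim (adjacent-gap sorted adj v∈ u<v v<w)
  ... | inj₂ eq  = eq

isCell⁺ : ∀ {M D S} → Cell ((0 , M) ∷ D) S → T (isCell (suc M) D S)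
isCell⁺ {M} {D} {S} c = Equivalence.from (T-∧ {3 <ᵇ suc (length S)})
  ( <⇒<ᵇ {3} (s≤s C.long)
  , all⁻ (cellTest (suc M) D S) (All.tabulate λ {e} e∈ → cellTest⁺ {suc M} {D} {S} (cyclic {e}) (chord e∈)))
  where
  module C = Cell c
  side : ∀ {e} → e ∈ (0 , M) ∷ D → T (isSide (suc M) e) ⊎ e ∈ D
  side (here refl) = inj₁ (isSide⁺ {M} (inj₂ refl))
  side (there e∈)  = inj₂ e∈
  cyclic : ∀ {e} → e ∈ cyclicPairs S → T (isSide (suc M) e) ⊎ e ∈ D
  cyclic e∈ with cyclicPairs⁻ S e∈
  ... | inj₂ refl = side C.closed
  ... | inj₁ adj with C.sides adj
  ...   | inj₁ unit = inj₁ (isSide⁺ (inj₁ unit))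
  ...   | inj₂ e∈D  = side e∈D
  chord : ∀ {e} → e ∈ orderedPairs S → e ∈ D → e ∈ cyclicPairs S
  chord e∈ e∈D with ordered-split C.sorted e∈
  ... | inj₁ adj = cyclicPairs⁺ˡ S adj
  ... | inj₂ (v , v∈ , u<v , v<w) with u∈ , w∈ , _ ← ordered⁻ C.sorted e∈ =
    subst (_∈ cyclicPairs S) (sym (C.empty (there e∈D) u∈ v∈ w∈ u<v v<w)) (cyclicPairs⁺ʳ C.long)

cells-↭ : ∀ {M D s Ks} → Inv M 0 (config ((0 , M) ∷ D) s Ks) → cells (suc M) D ↭ Ks
cells-↭ {M} {D} {s} {Ks} inv = unique-↭
  (Unique.filter⁺ (T? ∘ isCell (suc M) D) (sublists-unique (Unique.upTo⁺ (suc M)))) I.unique to from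
  where
  module I = Inv inv
  to : ∀ {S} → S ∈ cells (suc M) D → S ∈ Ks
  to S∈ with S∈′ , t ← ∈-filter⁻ (T? ∘ isCell (suc M) D) {xs = sublists (upTo (suc M))} S∈ =
    I.cell⁺ (isCell⁻ (∈-sublists⇒sorted (upTo-sorted (suc M)) S∈′) (λ v∈ → ≤-pred (∈-upTo⁻ (∈-sublists⇒⊆ S∈′ v∈))) t)
  from : ∀ {S} → S ∈ Ks → S ∈ cells (suc M) D
  from S∈ = ∈-filter⁺ (T? ∘ isCell (suc M) D)
    (∈-sublists⁺ (upTo-sorted (suc M)) (Cell.sorted c) λ v∈ → ∈-upTo⁺ (s≤s
      (≤-trans (proj₂ (top-≤ (Cell.sorted c) v∈)) (proj₂ (proj₂ (I.bounds (Cell.closed c)))))))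
    (isCell⁺ c)
    where c = I.cell⁻ S∈

cells-resp-↭ : ∀ N {D D′} → D ↭ D′ → cells N D ≡ cells N D′
cells-resp-↭ N {D} {D′} σ = filterᵇ-cong
  (λ S → cong ((3 <ᵇ suc (length S)) ∧_) (all-cong (test S) (orderedPairs S))) (sublists (upTo N))
  where
  test : ∀ S e → cellTest N D S e ≡ cellTest N D′ S e
  test S e = cong (λ z → if memEdge e (cyclicPairs S) then (isSide N e ∨ z) else not z) (memEdge-↭ e σ)

nonCrossing-resp-↭ : ∀ {D D′} → D ↭ D′ → pairwiseNonCrossing D ≡ pairwiseNonCrossing D′
nonCrossing-resp-↭ {D} {D′} σ = T-ext (transport σ) (transport (↭-sym σ))
  where
  transport : ∀ {D D′} → D ↭ D′ → T (pairwiseNonCrossing D) → T (pairwiseNonCrossing D′)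
  transport σ t = nonCrossing⁺ λ e∈ f∈ → nonCrossing⁻ t (∈-resp-↭ (↭-sym σ) e∈) (∈-resp-↭ (↭-sym σ) f∈)

-- From dissections to single trees, and the formula

last-only : ∀ {x xs} → Sorted (x ∷ xs) → lastOf x xs ≡ x → xs ≡ []
last-only {xs = []}     _        _  = refl
last-only {xs = y ∷ ys} (x< ∷ s) eq = contradiction
  (<-≤-trans (All.head x<) (≤-trans (≤-lastOf s (here refl)) (≤-reflexive eq))) (<-irrefl refl)

last-∈chain : ∀ {M a c} → Inv M a c → a < M → M ∈ chain c
last-∈chain {M} {a} {c} inv a<M with subst (_∈ a ∷ chain c) (Inv.last inv) (lastOf-∈ a (chain c))
... | here refl = contradiction a<M (<-irrefl refl)
... | there M∈  = M∈

module _ (ℓ : ℕ) (0<ℓ : 0 < ℓ) where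
  open Count ℓ 0<ℓ

  -- Adding the root edge turns a dissection into a forest consisting of a single tree.
  root-merge : ∀ {j c} m → Inv (2 + j) 0 c × Fresh 0 (2 + j) c →
    (length (cells (3 + j) (edges c)) ≡ᵇ m) ∧ isPeriodic ℓ (3 + j) (edges c) ≡
    maybe′ (isForest 1 m) false (merge 0 (2 + j) c)
  root-merge {j} {c} m (inv , fresh) with merge 0 (2 + j) c | mergeView 0 (2 + j) c
  ... | _ | unmerged b∉ = contradiction (last-∈chain inv (s≤s z≤n)) b∉
  ... | _ | merged {D} {Ks} pre post = begin
    (length (cells (3 + j) D) ≡ᵇ m) ∧ all ok (cells (3 + j) D)
      ≡⟨ cong₂ (λ x y → (x ≡ᵇ m) ∧ y) (↭-length σ) (all-↭ ok σ) ⟩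
    good m Ks′
      ≡⟨ T-ext (λ t → Equivalence.from T-∧ (t , single)) (proj₁ ∘ Equivalence.to T-∧) ⟩
    good m Ks′ ∧ (length post ≡ᵇ 0)                ∎
    where
    open ≡-Reasoning
    ok : List ℕ → Bool
    ok S = periodic (length S)
    Ks′ = (0 ∷ pre ++ 2 + j ∷ []) ∷ Ks
    inv′ : Inv (2 + j) 0 (config ((0 , 2 + j) ∷ D) (2 + j ∷ post) Ks′)
    inv′ = Merge.inv-merge (s≤s (s≤s z≤n)) inv fresh
    σ : cells (3 + j) D ↭ Ks′
    σ = cells-↭ inv′
    single : T (length post ≡ᵇ 0)
    single = subst (λ xs → T (length xs ≡ᵇ 0)) (sym (last-only (AllPairs.tail (Inv.sorted inv′)) (Inv.last inv′))) _

  dissections≡trees : ∀ j m → D[ ℓ ] (suc j) , m ≡ F 0 (2 + j) 1 m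
  -- The polygon size `suc j + 2` reduces only to `suc (j + 2)`; the rewrite brings it to the form 3
  -- + j.
  dissections≡trees j m rewrite +-comm j 2 = begin
    length (filterᵇ P (sublists (diagonals (3 + j))))     ≡⟨ length-filterᵇ P (sublists (diagonals (3 + j))) ⟩
    count P (sublists (diagonals (3 + j)))                ≡⟨ count-sublists-↭ (diagonals-↭ j) P P-resp ⟩
    count P (sublists R)                                  ≡⟨ count-∧ pairwiseNonCrossing Q (sublists R) ⟩
    count Q (filterᵇ pairwiseNonCrossing (sublists R))
      ≡⟨ cong (count Q) (block-nonCrossing j (n≤1+n (suc j)) invs (configs-nonCrossing 1 (suc j))) ⟩
    count Q (map edges bl)                                ≡⟨ count-map Q edges bl ⟩
    count (Q ∘ edges) bl                                  ≡⟨ count-cong (All.map (root-merge m) inv) ⟩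
    count (maybe′ p false ∘ merge 0 (2 + j)) bl           ≡⟨ count-mapMaybe p (merge 0 (2 + j)) bl ⟨
    count p (mapMaybe (merge 0 (2 + j)) bl)               ≡⟨ +-identityʳ _ ⟨
    count p (mapMaybe (merge 0 (2 + j)) bl) + 0
      ≡⟨ cong (count p (mapMaybe (merge 0 (2 + j)) bl) +_) (count-0 (All.map unclosed inv)) ⟨
    count p (mapMaybe (merge 0 (2 + j)) bl) + count p bl  ≡⟨ count-++ p (mapMaybe (merge 0 (2 + j)) bl) bl ⟨
    F 0 (2 + j) 1 m                                       ∎
    where
    open ≡-Reasoning
    Q P : List Edge → Bool
    Q D = (length (cells (3 + j) D) ≡ᵇ m) ∧ isPeriodic ℓ (3 + j) D
    P D = pairwiseNonCrossing D ∧ Q D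
    p = isForest 1 m
    R = blockEdges 0 j (edgesFrom 1 (suc j))
    bl = blockConfigs 0 j (map (leaf 1) (configs 1 (suc j)))
    invs : All (Inv (2 + j) 1) (configs 1 (suc j))
    invs = inv-configs 1 (suc j)
    inv : All (λ c → Inv (2 + j) 0 c × Fresh 0 (2 + j) c) bl
    inv = inv-block j invs
    P-resp : ∀ {D D′} → D ↭ D′ → P D ≡ P D′
    P-resp σ = cong₂ _∧_ (nonCrossing-resp-↭ σ)
      (cong (λ z → (length z ≡ᵇ m) ∧ all (λ S → periodic (length S)) z) (cells-resp-↭ (3 + j) σ))
    -- Without the root edge the chain from 0 to 2 + j cannot be a single edge, so omitting the root
    -- edge adds nothing to `F` at k = 1.
    unclosed : ∀ {c} → Inv (2 + j) 0 c × Fresh 0 (2 + j) c → ¬ T (isForest 1 m c)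
    unclosed {config D s Ks} (i , fresh) t with s | Inv.last i | Inv.sides i | proj₂ (Equivalence.to (T-∧ {good m Ks}) t)
    ... | []         | ()   | _     | _
    ... | _ ∷ _ ∷ _  | _    | _     | ()
    ... | _ ∷ []     | refl | sides | _ with sides (here refl)
    ...   | inj₁ ()
    ...   | inj₂ e∈ = <-irrefl refl (fresh e∈)

  trees-0 : ∀ n m → .{{_ : NonZero ℓ}} → m % ℓ ≢ n % ℓ → F 0 (suc n) 1 m ≡ 0
  trees-0 n m m≢n = count-0 (All.map none (inv-configs 0 (suc n)))
    where
    none : ∀ {c} → Inv (suc n) 0 c → ¬ T (isForest 1 m c)
    none {c} inv t with g , r ← Equivalence.to (T-∧ {good m (faces c)}) t
      with q , eq ← good-balance {0} {suc n} {c = c} inv g =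
      m≢n (sym (trans (cong (_% ℓ) (suc-injective (trans eq (cong (_+ (m + q * ℓ)) (≡ᵇ⇒≡ (length (chain c)) 1 r)))))
        ([m+kn]%n≡m%n m q ℓ)))

congruent-offset : ∀ {ℓ m n} .{{_ : NonZero ℓ}} → m ≤ n → m % ℓ ≡ n % ℓ → ∃ λ q → n ≡ m + q * ℓ
congruent-offset {ℓ} {m} {n} m≤n eq = n / ℓ ∸ m / ℓ , (begin
  n                                               ≡⟨ m≡m%n+[m/n]*n n ℓ ⟩
  n % ℓ + n / ℓ * ℓ                               ≡⟨ cong₂ (λ x y → x + y * ℓ) (sym eq) (sym (m+[n∸m]≡n (/-monoˡ-≤ ℓ m≤n))) ⟩
  m % ℓ + (m / ℓ + (n / ℓ ∸ m / ℓ)) * ℓ           ≡⟨ cong (m % ℓ +_) (*-distribʳ-+ ℓ (m / ℓ) _) ⟩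
  m % ℓ + (m / ℓ * ℓ + (n / ℓ ∸ m / ℓ) * ℓ)       ≡⟨ +-assoc (m % ℓ) _ _ ⟨
  m % ℓ + m / ℓ * ℓ + (n / ℓ ∸ m / ℓ) * ℓ         ≡⟨ cong (_+ (n / ℓ ∸ m / ℓ) * ℓ) (m≡m%n+[m/n]*n m ℓ) ⟨
  m + (n / ℓ ∸ m / ℓ) * ℓ                         ∎)
  where open ≡-Reasoning

theorem3p9 : (ℓ n m : ℕ) .{{_ : NonZero ℓ}} → 0 < m → m ≤ n →
    (m % ℓ ≢ n % ℓ → D[ ℓ ] n , m ≡ 0) ×
    (m % ℓ ≡ n % ℓ →
    (n + 1) * (D[ ℓ ] n , m) ≡ ((m ∸ 1 + (n ∸ m) / ℓ) C (m ∸ 1)) * ((n + m) C m))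
theorem3p9 ℓ n@(suc j) m@(suc i) 0<m m≤n =
  (λ m≢n → trans (dissections≡trees ℓ 0<ℓ j m) (trees-0 ℓ 0<ℓ n m m≢n)) ,
  (λ m≡n → let q , eq = congruent-offset m≤n m≡n in formula q eq)
  where
  open ≡-Reasoning
  0<ℓ : 0 < ℓ
  0<ℓ = >-nonZero⁻¹ ℓ
  open Count ℓ 0<ℓ using (F; F-tree)
  formula : ∀ q → n ≡ m + q * ℓ → (n + 1) * (D[ ℓ ] n , m) ≡ ((i + (n ∸ m) / ℓ) C i) * ((n + m) C m)
  formula q eq = begin
    (n + 1) * (D[ ℓ ] n , m)
      ≡⟨ cong₂ _*_ (+-comm n 1) (dissections≡trees ℓ 0<ℓ j m) ⟩
    suc n * F 0 (suc n) 1 m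
      ≡⟨ subst (λ z → suc z * F 0 (suc z) 1 m ≡ ((i + q) C i) * ((z + m) C m)) (sym eq) (F-tree 0 i q) ⟩
    ((i + q) C i) * ((n + m) C m)
      ≡⟨ cong (λ z → ((i + z) C i) * ((n + m) C m)) quotient ⟨
    ((i + (n ∸ m) / ℓ) C i) * ((n + m) C m) ∎
    where
    quotient : (n ∸ m) / ℓ ≡ q
    quotient = trans (cong (λ z → (z ∸ m) / ℓ) eq) (trans (cong (_/ ℓ) (m+n∸m≡n m (q * ℓ))) (m*n/n≡m q ℓ))
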